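{- The Markov spectrum $\mathcal{M}$ of $\mathbb{Q}((1/T))$ equals $$\{M(A): A=(g_i)_{i\in\mathbb{Z}} \text{ a doubly infinite sequence of polynomials } g_i\in\mathbb{Q}[T] \text{ with } \deg g_i\ge1\}.$$
   Context: $\mathbb{Q}((1/T))$ is the field of formal Laurent series in $1/T$ over $\mathbb{Q}$; $\deg$ of a nonzero series is the exponent of its leading term, $\deg0=-\infty$. For polynomials $c_0,c_1,\dots$ with $\deg c_j\ge1$ for $j\ge1$, $[c_0,c_1,\dots]=c_0+1/(c_1+1/(c_2+\cdots))$ converges in $\mathbb{Q}((1/T))$. For a doubly infinite sequence $A=(g_i)_{i\in\mathbb{Z}}$ of polynomials of positive degree, $\lambda_i(A)=[g_i,g_{i+1},\dots]+[0,g_{i-1},g_{i-2},\dots]$ and $M(A)=\sup_{i\in\mathbb{Z}}\deg\lambda_i(A)\in\mathbb{Z}\cup\{\infty\}$. A binary quadratic form is $Q=AX^2+BXY+CY^2$ with $A,B,C\in\mathbb{Q}((1/T))$ not all in $\mathbb{Q}(T)$, discriminant $D=B^2-4AC$; it is indefinite if $D\ne0$ is a square in $\mathbb{Q}((1/T))$. $m(Q)=\inf\{\deg Q(X,Y):X,Y\in\mathbb{Q}[T],(X,Y)\ne(0,0)\}$, and $\mathcal{M}=\{\tfrac{\deg D}{2}-m(Q):Q\text{ indefinite}\}$, with value $+\infty$ when $m(Q)=-\infty$. -}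

module Defs where

open import Data.Empty using (⊥)
open import Data.Integer using (ℤ; +_; -[1+_])
import Data.Integer as ℤ
open import Data.List using (List; []; _∷_; foldr; applyUpTo)
open import Data.Nat using (ℕ; zero; suc; _∸_)
import Data.Nat as ℕ
open import Data.Product using (_×_; ∃; ∃-syntax)
open import Data.Rational using (ℚ; 0ℚ; 1ℚ)
import Data.Rational as ℚ
open import Function using (_∘_)
open import Level using (0ℓ)
open import Relation.Binary.PropositionalEquality using (_≡_; _≢_)
open import Relation.Nullary using (¬_)
open import Relation.Nullary.Construct.Add.Extrema using (_±; ⊥±; ⊤±; [_])
open import Relation.Binary.Construct.Add.Extrema.NonStrict ℤ._≤_ using (_≤±_)
open import Relation.Unary using (Pred; _∈_)

infix  4 _≈_ _≉_
infixl 6 _+_ _-_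
infixl 7 _*_
infix  8 -_

-- The field ℚ((1/T)).  A series is  Σ_{j ≥ 0} (digit j) T^(bound - j);  leading
-- digits may vanish, so one series has many representations, identified by _≈_.

record Laurent : Set where
  constructor mkLaurent
  field
    bound : ℤ
    digit : ℕ → ℚ

open Laurent public

at : (ℕ → ℚ) → ℤ → ℚ
at a (+ j)    = a j
at a -[1+ _ ] = 0ℚ

-- The coefficient of T^k.
coeff : Laurent → ℤ → ℚ
coeff f k = at (digit f) (bound f ℤ.- k)

_≈_ : Laurent → Laurent → Set
f ≈ g = ∀ k → coeff f k ≡ coeff g k

_≉_ : Laurent → Laurent → Set
f ≉ g = ¬ (f ≈ g)

leading : ℚ → ℕ → ℚ
leading q zero    = q
leading q (suc _) = 0ℚ

-- q T^n
monomial : ℚ → ℤ → Laurent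
monomial q n = mkLaurent n (leading q)

const : ℚ → Laurent
const q = monomial q (+ 0)

0# 1# T : Laurent
0# = const 0ℚ
1# = const 1ℚ
T  = monomial 1ℚ (+ 1)

_+_ : Laurent → Laurent → Laurent
f + g = mkLaurent b λ j → coeff f (b ℤ.- + j) ℚ.+ coeff g (b ℤ.- + j)
  where b = bound f ℤ.⊔ bound g

-_ : Laurent → Laurent
- f = mkLaurent (bound f) (λ j → ℚ.- digit f j)

_-_ : Laurent → Laurent → Laurent
f - g = f + (- g)

_*_ : Laurent → Laurent → Laurent
f * g = mkLaurent (bound f ℤ.+ bound g) λ n →
  foldr ℚ._+_ 0ℚ (applyUpTo (λ i → digit f i ℚ.* digit g (n ∸ i)) (suc n))

-- Degrees and the values of suprema and infima live in ℤ ∪ {-∞, +∞}, written ℤ ±.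

-- IsDeg f d  says  deg f = d;  it is a relation because whether a series vanishes
-- is not decidable.
IsDeg : Laurent → ℤ ± → Set
IsDeg f ⊥±    = f ≈ 0#
IsDeg f [ d ] = coeff f d ≢ 0ℚ × (∀ k → d ℤ.< k → coeff f k ≡ 0ℚ)
IsDeg f ⊤±    = ⊥

IsSup : Pred (ℤ ±) 0ℓ → ℤ ± → Set
IsSup S s = (∀ d → d ∈ S → d ≤± s) × (∀ u → (∀ d → d ∈ S → d ≤± u) → s ≤± u)

IsInf : Pred (ℤ ±) 0ℓ → ℤ ± → Set
IsInf S s = (∀ d → d ∈ S → s ≤± d) × (∀ u → (∀ d → d ∈ S → u ≤± d) → u ≤± s)

-- ℚ[T]: lists of coefficients, constant term first, with trailing zeros allowed;
-- ⟦_⟧ is the inclusion in ℚ((1/T)).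

Poly : Set
Poly = List ℚ

⟦_⟧ : Poly → Laurent
⟦ [] ⟧    = 0#
⟦ a ∷ p ⟧ = const a + T * ⟦ p ⟧

-- Membership in ℚ(T).
IsRational : Laurent → Set
IsRational f = ∃[ p ] ∃[ q ] (⟦ q ⟧ ≉ 0# × ⟦ q ⟧ * f ≈ ⟦ p ⟧)

PositiveDegree : Poly → Set
PositiveDegree p = ∃[ d ] (+ 1 ℤ.≤ d × IsDeg ⟦ p ⟧ [ d ])

-- FiniteCF c n f  says  f = [c 0, …, c n];  the reciprocal of x is the y with x * y ≈ 1#.
FiniteCF : (ℕ → Poly) → ℕ → Laurent → Set
FiniteCF c zero    f = f ≈ ⟦ c 0 ⟧
FiniteCF c (suc n) f =
  ∃[ x ] ∃[ y ] (FiniteCF (c ∘ suc) n x × x * y ≈ 1# × f ≈ ⟦ c 0 ⟧ + y)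

-- Convergence in ℚ((1/T)):  deg (f - h n) → -∞.
_⟶_ : (ℕ → Laurent) → Laurent → Set
h ⟶ f = ∀ k → ∃[ N ] (∀ n → N ℕ.≤ n → ∀ j → k ℤ.≤ j → coeff (h n) j ≡ coeff f j)

-- f = [c 0, c 1, …]
IsCF : (ℕ → Poly) → Laurent → Set
IsCF c f = ∃[ h ] ((∀ n → FiniteCF c n (h n)) × h ⟶ f)

rightOf leftOf : (ℤ → Poly) → ℤ → ℕ → Poly
rightOf g i n      = g (i ℤ.+ + n)
leftOf g i zero    = []
leftOf g i (suc n) = g (i ℤ.- + suc n)

-- λ_i(A) = [g_i, g_{i+1}, …] + [0, g_{i-1}, g_{i-2}, …]
IsLambda : (ℤ → Poly) → ℤ → Laurent → Set
IsLambda g i l =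
  ∃[ x ] ∃[ y ] (IsCF (rightOf g i) x × IsCF (leftOf g i) y × l ≈ x + y)

-- M(A) = s, where A = (g_i)
IsM : (ℤ → Poly) → ℤ ± → Set
IsM g = IsSup λ d → ∃[ i ] ∃[ l ] (IsLambda g i l × IsDeg l d)

SequenceValues : Pred (ℤ ±) 0ℓ
SequenceValues v = ∃[ g ] ((∀ i → PositiveDegree (g i)) × IsM g v)

record QuadraticForm : Set where
  field
    A B C          : Laurent
    notAllRational : ¬ (IsRational A × IsRational B × IsRational C)

  disc : Laurent
  disc = B * B - const (+ 4 ℚ./ 1) * (A * C)

  eval : Laurent → Laurent → Laurent
  eval x y = A * (x * x) + B * (x * y) + C * (y * y)

  Indefinite : Set
  Indefinite = disc ≉ 0# × ∃[ δ ] (δ * δ ≈ disc)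

  -- m(Q) = s
  IsMin : ℤ ± → Set
  IsMin = IsInf λ d → ∃[ X ] ∃[ Y ]
    (¬ (⟦ X ⟧ ≈ 0# × ⟦ Y ⟧ ≈ 0#) × IsDeg (eval ⟦ X ⟧ ⟦ Y ⟧) d)

  -- (deg D)/2 - m(Q) = v.  In the finite case the equation is multiplied by 2;
  -- deg D is even for an indefinite form, so v being an integer loses nothing.
  IsValue : ℤ ± → Set
  IsValue ⊥±    = ⊥
  IsValue [ v ] = ∃[ d ] ∃[ m ]
    (IsDeg disc [ d ] × IsMin [ m ] × + 2 ℤ.* v ≡ d ℤ.- + 2 ℤ.* m)
  IsValue ⊤±    = IsMin ⊥±

open QuadraticForm public using (Indefinite; IsValue)

MarkovSpectrum : Pred (ℤ ±) 0ℓ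
MarkovSpectrum v = ∃[ Q ] (Indefinite Q × IsValue Q v)

{-# OPTIONS --safe #-}

-- Both sets are {1, 2, 3, …, +∞}.  Since λ_i differs from g_i by a series of negative
-- degree, M(A) is the supremum of the deg g_i; constant sequences T^n and the sequence
-- T^(|i|+1) attain all values.
--
-- On the other side let θ = (δ - B)/2A with δ² = D, let X be the polynomial part of θ
-- and ε = X - θ.  Then Q(X, 1) = A ε² + δ ε has degree at most the larger of deg A - 2
-- and deg D/2 - 1.  Replacing the basis by (X, 1), (1, 0) and repeating gives a nonzero
-- vector with deg Q ≤ deg D/2 - 1, so the values are at least 1.  With r² = T² - 1 the
-- form r (X² - T^(2k) (T² - 1) Y²) has the value k + 1: the factor in parentheses is a
-- nonzero polynomial on nonzero vectors, because X² = (T² - 1) Z² reads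
-- X(0)² + Z(0)² = 0 at T = 0, so T divides X and Z, and one descends.  The value +∞ is
-- attained by r X Y.
module Submission where

open import Defs hiding (_+_; _-_; _*_; -_; const; 0#; 1#)
open import Algebra.Bundles using (CommutativeRing)
import Algebra.Solver.Ring as RingSolver
open import Algebra.Solver.Ring.AlmostCommutativeRing
  using (fromCommutativeRing; _-Raw-AlmostCommutative⟶_)
open import Data.Empty using (⊥; ⊥-elim)
open import Data.Integer using (ℤ; +_; -[1+_])
import Data.Integer as ℤ
import Data.Integer.Properties as ℤ
open import Data.Integer.Tactic.RingSolver using (solve-∀)
open import Data.List using ([]; _∷_)
open import Data.Maybe using (Maybe; just; nothing)
open import Data.Nat using (ℕ; zero; suc; z≤n; s≤s)
import Data.Nat as ℕ
import Data.Nat.Properties as ℕ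
open import Data.Product using (_×_; _,_; ∃-syntax; proj₁; proj₂)
open import Data.Rational using (ℚ; 0ℚ; 1ℚ)
import Data.Rational as ℚ
import Data.Rational.Properties as ℚ
open import Data.Rational.Solver using (module +-*-Solver)
open import Data.Sum using (inj₁; inj₂)
open import Data.Unit using (⊤; tt)
open import Function using (_∘_)
open import Level using (0ℓ)
open import Relation.Binary.Construct.Add.Extrema.NonStrict ℤ._≤_ using (_≤±_; [≤]-injective; _≤⊤±)
import Relation.Binary.Construct.Add.Extrema.NonStrict ℤ._≤_ as ≤±
import Relation.Binary.Construct.Add.Supremum.NonStrict as Sup
open import Relation.Binary.PropositionalEquality
  using (_≡_; _≢_; _≗_; refl; sym; trans; cong; cong₂; subst; module ≡-Reasoning)
import Relation.Binary.Reasoning.Setoid as SetoidReasoning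
open import Relation.Nullary using (¬_; yes; no; contradiction)
open import Relation.Nullary.Construct.Add.Extrema using (_±; ⊥±; ⊤±; [_])
open import Relation.Unary using (Pred; _∈_; _≐_)

-- Sequences and the Cauchy product

-- A series cannot be tested for zero, so its degree cannot be computed. The arguments therefore run
-- on upper bounds of degrees, which every representation supplies. An exact degree is gained by
-- testing the single rational coefficient at the bound, each descent recurses on the excess of a
-- bound over its target, and "nonzero, hence of some degree" is used only inside a refutation.
--
-- The polynomial T² - 1 is chosen for its two ends. Its leading term T² is a square, so it has a
-- root r in ℚ((1/T)). Its constant term -1 is not a square in ℚ, so r is not in ℚ(T). The factor r
-- in front of the forms makes their coefficients irrational, as the definition of a form demands;
-- it adds deg r = 1 to both deg D/2 and m(Q) and so leaves the value as it is. The factor T^(2k)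
-- adds k to deg D/2, while the minimum is still taken at (1, 0).

Seq : Set
Seq = ℕ → ℚ

-- The digits of a product do not depend on the bounds of the factors.
conv : Seq → Seq → Seq
conv a b = digit (mkLaurent (+ 0) a Defs.* mkLaurent (+ 0) b)

-- Digit `n` of a product sees only digits up to `n` of the factors. This causality is what later
-- allows reciprocals and a square root to be defined by recursion on digits.
conv-local : ∀ {a a′ b b′} n → (∀ i → i ℕ.≤ n → a i ≡ a′ i) → (∀ i → i ℕ.≤ n → b i ≡ b′ i) →
  conv a b n ≡ conv a′ b′ n
conv-local zero    p q = cong₂ (λ x y → x ℚ.* y ℚ.+ 0ℚ) (p 0 z≤n) (q 0 z≤n)
conv-local (suc n) p q = cong₂ ℚ._+_
  (cong₂ ℚ._*_ (p 0 z≤n) (q (suc n) ℕ.≤-refl))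
  (conv-local n (λ i i≤n → p (suc i) (s≤s i≤n)) (λ i i≤n → q i (ℕ.m≤n⇒m≤1+n i≤n)))

conv-cong : ∀ {a a′ b b′} → a ≗ a′ → b ≗ b′ → conv a b ≗ conv a′ b′
conv-cong p q n = conv-local n (λ i _ → p i) (λ i _ → q i)

-- `conv` unfolds at its first term. Commutativity, and the square of a series with leading digit 1,
-- also need the last term split off.
conv-sucʳ : ∀ a b n → conv a b (suc n) ≡ conv a (b ∘ suc) n ℚ.+ a (suc n) ℚ.* b 0
conv-sucʳ a b zero    = solve 4 (λ x y z w → x :* y :+ (z :* w :+ con 0ℚ) := x :* y :+ con 0ℚ :+ z :* w)
  refl (a 0) (b 1) (a 1) (b 0)
  where open +-*-Solver
conv-sucʳ a b (suc n) = trans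
  (cong (a 0 ℚ.* b (suc (suc n)) ℚ.+_) (conv-sucʳ (a ∘ suc) b n))
  (sym (ℚ.+-assoc (a 0 ℚ.* b (suc (suc n))) _ _))

conv-comm : ∀ a b → conv a b ≗ conv b a
conv-comm a b zero    = cong (ℚ._+ 0ℚ) (ℚ.*-comm (a 0) (b 0))
conv-comm a b (suc n) = begin
  a 0 ℚ.* b (suc n) ℚ.+ conv (a ∘ suc) b n
    ≡⟨ cong₂ ℚ._+_ (ℚ.*-comm (a 0) (b (suc n))) (conv-comm (a ∘ suc) b n) ⟩
  b (suc n) ℚ.* a 0 ℚ.+ conv b (a ∘ suc) n
    ≡⟨ ℚ.+-comm (b (suc n) ℚ.* a 0) _ ⟩
  conv b (a ∘ suc) n ℚ.+ b (suc n) ℚ.* a 0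
    ≡⟨ conv-sucʳ b a n ⟨
  conv b a (suc n) ∎
  where open ≡-Reasoning

conv-distribʳ : ∀ a b c n → conv (λ i → a i ℚ.+ b i) c n ≡ conv a c n ℚ.+ conv b c n
conv-distribʳ a b c zero    =
  solve 3 (λ x y z → (x :+ y) :* z :+ con 0ℚ := (x :* z :+ con 0ℚ) :+ (y :* z :+ con 0ℚ))
    refl (a 0) (b 0) (c 0)
  where open +-*-Solver
conv-distribʳ a b c (suc n) = trans
  (cong ((a 0 ℚ.+ b 0) ℚ.* c (suc n) ℚ.+_) (conv-distribʳ (a ∘ suc) (b ∘ suc) c n))
  (solve 5 (λ x y z u v → (x :+ y) :* z :+ (u :+ v) := (x :* z :+ u) :+ (y :* z :+ v))
    refl (a 0) (b 0) (c (suc n)) (conv (a ∘ suc) c n) (conv (b ∘ suc) c n))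
  where open +-*-Solver

conv-scale : ∀ q b c n → conv (λ i → q ℚ.* b i) c n ≡ q ℚ.* conv b c n
conv-scale q b c zero    =
  solve 3 (λ q y z → q :* y :* z :+ con 0ℚ := q :* (y :* z :+ con 0ℚ)) refl q (b 0) (c 0)
  where open +-*-Solver
conv-scale q b c (suc n) = trans
  (cong (q ℚ.* b 0 ℚ.* c (suc n) ℚ.+_) (conv-scale q (b ∘ suc) c n))
  (solve 4 (λ q y z u → q :* y :* z :+ q :* u := q :* (y :* z :+ u))
    refl q (b 0) (c (suc n)) (conv (b ∘ suc) c n))
  where open +-*-Solver

conv-assoc : ∀ a b c → conv (conv a b) c ≗ conv a (conv b c)
conv-assoc a b c zero    =
  solve 3 (λ x y z → (x :* y :+ con 0ℚ) :* z :+ con 0ℚ := x :* (y :* z :+ con 0ℚ) :+ con 0ℚ)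
    refl (a 0) (b 0) (c 0)
  where open +-*-Solver
conv-assoc a b c (suc n) = begin
  (a 0 ℚ.* b 0 ℚ.+ 0ℚ) ℚ.* c (suc n) ℚ.+ conv (λ i → a 0 ℚ.* b (suc i) ℚ.+ conv (a ∘ suc) b i) c n
    ≡⟨ cong ((a 0 ℚ.* b 0 ℚ.+ 0ℚ) ℚ.* c (suc n) ℚ.+_)
         (conv-distribʳ (λ i → a 0 ℚ.* b (suc i)) (conv (a ∘ suc) b) c n) ⟩
  (a 0 ℚ.* b 0 ℚ.+ 0ℚ) ℚ.* c (suc n) ℚ.+
    (conv (λ i → a 0 ℚ.* b (suc i)) c n ℚ.+ conv (conv (a ∘ suc) b) c n)
    ≡⟨ cong ((a 0 ℚ.* b 0 ℚ.+ 0ℚ) ℚ.* c (suc n) ℚ.+_)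
         (cong₂ ℚ._+_ (conv-scale (a 0) (b ∘ suc) c n) (conv-assoc (a ∘ suc) b c n)) ⟩
  (a 0 ℚ.* b 0 ℚ.+ 0ℚ) ℚ.* c (suc n) ℚ.+
    (a 0 ℚ.* conv (b ∘ suc) c n ℚ.+ conv (a ∘ suc) (conv b c) n)
    ≡⟨ solve 5 (λ x y z u v → (x :* y :+ con 0ℚ) :* z :+ (x :* u :+ v) := x :* (y :* z :+ u) :+ v)
         refl (a 0) (b 0) (c (suc n)) (conv (b ∘ suc) c n) (conv (a ∘ suc) (conv b c) n) ⟩
  conv a (conv b c) (suc n) ∎
  where open ≡-Reasoning
        open +-*-Solver

conv-zeroˡ : ∀ {a} b → (∀ i → a i ≡ 0ℚ) → ∀ n → conv a b n ≡ 0ℚ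
conv-zeroˡ b z zero    = trans (cong (λ x → x ℚ.* b 0 ℚ.+ 0ℚ) (z 0)) (trans (ℚ.+-identityʳ _) (ℚ.*-zeroˡ (b 0)))
conv-zeroˡ b z (suc n) = trans
  (cong₂ (λ x y → x ℚ.* b (suc n) ℚ.+ y) (z 0) (conv-zeroˡ b (z ∘ suc) n))
  (trans (ℚ.+-identityʳ _) (ℚ.*-zeroˡ (b (suc n))))

conv-leading : ∀ q b n → conv (leading q) b n ≡ q ℚ.* b n
conv-leading q b zero    = ℚ.+-identityʳ _
conv-leading q b (suc n) = trans (cong (q ℚ.* b (suc n) ℚ.+_) (conv-zeroˡ b (λ _ → refl) n)) (ℚ.+-identityʳ _)

pad : ℕ → Seq → Seq
pad zero    a j       = a j
pad (suc n) a zero    = 0ℚ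
pad (suc n) a (suc j) = pad n a j

conv-pad : ∀ n a b → conv (pad n a) b ≗ pad n (conv a b)
conv-pad zero    a b j       = refl
conv-pad (suc n) a b zero    = trans (ℚ.+-identityʳ _) (ℚ.*-zeroˡ (b 0))
conv-pad (suc n) a b (suc j) = trans
  (cong₂ ℚ._+_ (ℚ.*-zeroˡ (b (suc j))) (conv-pad n a b j)) (ℚ.+-identityˡ _)

-- Digit `n` of `F a` depends only on earlier digits of `a`, so starting from the zero sequence it
-- is settled after `suc n` iterations. The diagonal of the iterates is then a fixed point.
module Recursion (F : Seq → Seq) (causal : ∀ a b n → (∀ i → i ℕ.< n → a i ≡ b i) → F a n ≡ F b n) where

  iterate : ℕ → Seq
  iterate zero    = λ _ → 0ℚ
  iterate (suc k) = F (iterate k)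

  stable : ∀ k l n → n ℕ.< k → n ℕ.< l → iterate k n ≡ iterate l n
  stable (suc k) (suc l) n (s≤s n≤k) (s≤s n≤l) = causal _ _ n λ i i<n →
    stable k l i (ℕ.<-≤-trans i<n n≤k) (ℕ.<-≤-trans i<n n≤l)

  fix : Seq
  fix n = iterate (suc n) n

  fix-eq : fix ≗ F fix
  fix-eq n = causal _ _ n λ i i<n → stable n (suc i) i i<n ℕ.≤-refl

-- Laurent series

-- An exponent is either that of digit `j` of a series with bound `b` or lies above all digits. The
-- constructors carry the natural number that a case split on `b ℤ.- k` would leave behind an
-- equation.
data Position (b : ℤ) : ℤ → Set where
  within : ∀ j → Position b (b ℤ.- + j)
  above  : ∀ j → Position b (b ℤ.+ + suc j)

position : ∀ b k → Position b k
position b k with b ℤ.- k in eq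
... | + j      = subst (Position b) (trans (cong (λ x → b ℤ.- x) (sym eq)) (lem b k)) (within j)
  where lem : ∀ b k → b ℤ.- (b ℤ.- k) ≡ k
        lem = solve-∀
... | -[1+ j ] = subst (Position b) (trans (cong (λ x → b ℤ.- x) (sym eq)) (lem b k)) (above j)
  where lem : ∀ b k → b ℤ.- (b ℤ.- k) ≡ k
        lem = solve-∀

within-≤ : ∀ b j → b ℤ.- + j ℤ.≤ b
within-≤ b j = ℤ.i-j≤i b (+ j)

above-> : ∀ b j → b ℤ.< b ℤ.+ + suc j
above-> b j = subst (ℤ._< b ℤ.+ + suc j) (ℤ.+-identityʳ b) (ℤ.+-monoʳ-< b (ℤ.+<+ (s≤s z≤n)))

at-within : ∀ a b j → at a (b ℤ.- (b ℤ.- + j)) ≡ a j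
at-within a b j = cong (at a) (lem b (+ j))
  where lem : ∀ b k → b ℤ.- (b ℤ.- k) ≡ k
        lem = solve-∀

at-above : ∀ a b j → at a (b ℤ.- (b ℤ.+ + suc j)) ≡ 0ℚ
at-above a b j = cong (at a) (lem b (+ suc j))
  where lem : ∀ b k → b ℤ.- (b ℤ.+ k) ≡ ℤ.- k
        lem = solve-∀

coeff-within : ∀ f j → coeff f (bound f ℤ.- + j) ≡ digit f j
coeff-within f = at-within (digit f) (bound f)

coeff-above : ∀ f {k} → bound f ℤ.< k → coeff f k ≡ 0ℚ
coeff-above f {k} b<k with position (bound f) k
... | within j = contradiction (within-≤ (bound f) j) (ℤ.<⇒≱ b<k)
... | above j  = at-above (digit f) (bound f) j

-- _≈_ unfolds to a function type, from which the two series cannot be inferred.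
infix 4 _≋_
record _≋_ (f g : Laurent) : Set where
  constructor mk≋
  field un≋ : f ≈ g
open _≋_

-- Bounds of degrees, unlike degrees, exist for every series and pass through sums and products
-- without knowing whether anything vanishes.
record DegLe (f : Laurent) (d : ℤ) : Set where
  constructor degLe
  field vanish : ∀ k → d ℤ.< k → coeff f k ≡ 0ℚ
open DegLe

≋-refl : ∀ {f} → f ≋ f
≋-refl = mk≋ λ _ → refl

≋-sym : ∀ {f g} → f ≋ g → g ≋ f
≋-sym (mk≋ p) = mk≋ λ k → sym (p k)

≋-trans : ∀ {f g h} → f ≋ g → g ≋ h → f ≋ h
≋-trans (mk≋ p) (mk≋ q) = mk≋ λ k → trans (p k) (q k)

DegLe-bound : ∀ f → DegLe f (bound f)
DegLe-bound f = degLe λ k → coeff-above f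

DegLe-mono : ∀ {f d e} → d ℤ.≤ e → DegLe f d → DegLe f e
DegLe-mono d≤e (degLe p) = degLe λ k e<k → p k (ℤ.≤-<-trans d≤e e<k)

DegLe-cong : ∀ {f g d} → f ≋ g → DegLe f d → DegLe g d
DegLe-cong (mk≋ e) (degLe p) = degLe λ k d<k → trans (sym (e k)) (p k d<k)

≋-from : ∀ {f g} b → DegLe f b → DegLe g b →
  (∀ j → coeff f (b ℤ.- + j) ≡ coeff g (b ℤ.- + j)) → f ≋ g
≋-from {f} {g} b p q e = mk≋ eq
  where
  eq : f ≈ g
  eq k with position b k
  ... | within j = e j
  ... | above j  = trans (vanish p _ (above-> b j)) (sym (vanish q _ (above-> b j)))

≋-digits : ∀ {b b′ a a′} → b ≡ b′ → a ≗ a′ → mkLaurent b a ≋ mkLaurent b′ a′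
≋-digits {b} {a = a} {a′} refl e = ≋-from b (DegLe-bound _) (DegLe-bound _) λ j →
  trans (at-within a b j) (trans (e j) (sym (at-within a′ b j)))

digitsFrom : ℤ → Laurent → Seq
digitsFrom b f j = coeff f (b ℤ.- + j)

rebase : ∀ {f b} → DegLe f b → f ≋ mkLaurent b (digitsFrom b f)
rebase {f} {b} p = ≋-from b p (DegLe-bound (mkLaurent b (digitsFrom b f))) λ j →
  sym (at-within (digitsFrom b f) b j)

-- Ring laws of ℚ((1/T))

module Raw where

  open Defs using (_+_; _*_; -_; const; 0#; 1#)

  coeff-+ : ∀ f g k → coeff (f + g) k ≡ coeff f k ℚ.+ coeff g k
  coeff-+ f g k with position (bound f ℤ.⊔ bound g) k
  ... | within j = at-within _ (bound f ℤ.⊔ bound g) j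
  ... | above j  = trans (at-above _ (bound f ℤ.⊔ bound g) j)
    (sym (cong₂ ℚ._+_
      (coeff-above f (ℤ.≤-<-trans (ℤ.i≤i⊔j _ _) (above-> (bound f ℤ.⊔ bound g) j)))
      (coeff-above g (ℤ.≤-<-trans (ℤ.i≤j⊔i (bound f) (bound g)) (above-> (bound f ℤ.⊔ bound g) j)))))

  coeff-neg : ∀ f k → coeff (- f) k ≡ ℚ.- coeff f k
  coeff-neg f k with bound f ℤ.- k
  ... | + j      = refl
  ... | -[1+ j ] = refl

  +-cong : ∀ {f f′ g g′} → f ≋ f′ → g ≋ g′ → f + g ≋ f′ + g′
  +-cong {f} {f′} {g} {g′} (mk≋ p) (mk≋ q) = mk≋ λ k →
    trans (coeff-+ f g k) (trans (cong₂ ℚ._+_ (p k) (q k)) (sym (coeff-+ f′ g′ k)))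

  neg-cong : ∀ {f g} → f ≋ g → - f ≋ - g
  neg-cong {f} {g} (mk≋ p) = mk≋ λ k →
    trans (coeff-neg f k) (trans (cong ℚ.-_ (p k)) (sym (coeff-neg g k)))

  coeff-0 : ∀ k → coeff 0# k ≡ 0ℚ
  coeff-0 k with + 0 ℤ.- k
  ... | + zero   = refl
  ... | + suc j  = refl
  ... | -[1+ j ] = refl

  +-assoc : ∀ f g h → f + g + h ≋ f + (g + h)
  +-assoc f g h = mk≋ λ k → begin
    coeff (f + g + h) k                        ≡⟨ coeff-+ (f + g) h k ⟩
    coeff (f + g) k ℚ.+ coeff h k              ≡⟨ cong (ℚ._+ coeff h k) (coeff-+ f g k) ⟩
    coeff f k ℚ.+ coeff g k ℚ.+ coeff h k      ≡⟨ ℚ.+-assoc (coeff f k) _ _ ⟩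
    coeff f k ℚ.+ (coeff g k ℚ.+ coeff h k)    ≡⟨ cong (coeff f k ℚ.+_) (coeff-+ g h k) ⟨
    coeff f k ℚ.+ coeff (g + h) k              ≡⟨ coeff-+ f (g + h) k ⟨
    coeff (f + (g + h)) k                      ∎
    where open ≡-Reasoning

  +-comm : ∀ f g → f + g ≋ g + f
  +-comm f g = mk≋ λ k →
    trans (coeff-+ f g k) (trans (ℚ.+-comm (coeff f k) _) (sym (coeff-+ g f k)))

  +-identityˡ : ∀ f → 0# + f ≋ f
  +-identityˡ f = mk≋ λ k →
    trans (coeff-+ 0# f k) (trans (cong (ℚ._+ coeff f k) (coeff-0 k)) (ℚ.+-identityˡ _))

  neg-inverseˡ : ∀ f → - f + f ≋ 0#
  neg-inverseˡ f = mk≋ λ k → trans (coeff-+ (- f) f k)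
    (trans (cong (ℚ._+ coeff f k) (coeff-neg f k)) (trans (ℚ.+-inverseˡ (coeff f k)) (sym (coeff-0 k))))

  *-comm : ∀ f g → f * g ≋ g * f
  *-comm f g = ≋-digits (ℤ.+-comm (bound f) (bound g)) (conv-comm (digit f) (digit g))

  *-assoc : ∀ f g h → f * g * h ≋ f * (g * h)
  *-assoc f g h = ≋-digits (ℤ.+-assoc (bound f) _ _) (conv-assoc (digit f) (digit g) (digit h))

  *-identityˡ : ∀ f → 1# * f ≋ f
  *-identityˡ f = ≋-digits (ℤ.+-identityˡ (bound f)) λ n →
    trans (conv-leading 1ℚ (digit f) n) (ℚ.*-identityˡ _)

  raise : ℕ → Laurent → Laurent
  raise n f = mkLaurent (bound f ℤ.+ + n) (pad n (digit f))

  ≋-raise : ∀ n f → f ≋ raise n f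
  ≋-raise zero    f = ≋-digits (sym (ℤ.+-identityʳ (bound f))) λ _ → refl
  ≋-raise (suc n) f = ≋-trans (≋-raise n f)
    (≋-trans (step (raise n f) (lem (bound f) (+ n))) (≋-digits refl (pad-suc n (digit f))))
    where
    lem : ∀ b n → + 1 ℤ.+ (b ℤ.+ n) ≡ b ℤ.+ (+ 1 ℤ.+ n)
    lem = solve-∀
    pad-suc : ∀ n a j → pad 1 (pad n a) j ≡ pad (suc n) a j
    pad-suc n a zero    = refl
    pad-suc n a (suc j) = refl
    step : ∀ g {b} → ℤ.suc (bound g) ≡ b → g ≋ mkLaurent b (pad 1 (digit g))
    step g refl = mk≋ eq
      where
      suc-1 : ∀ b j → + 1 ℤ.+ b ℤ.- (b ℤ.- j) ≡ + 1 ℤ.+ j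
      suc-1 = solve-∀
      suc-2 : ∀ b j → + 1 ℤ.+ b ℤ.- (b ℤ.+ (+ 1 ℤ.+ j)) ≡ ℤ.- j
      suc-2 = solve-∀
      eq : g ≈ mkLaurent (ℤ.suc (bound g)) (pad 1 (digit g))
      eq k with position (bound g) k
      ... | within j = trans (coeff-within g j) (cong (at (pad 1 (digit g))) (sym (suc-1 (bound g) (+ j))))
      ... | above j  = trans (coeff-above g (above-> (bound g) j))
        (trans (at-neg j) (cong (at (pad 1 (digit g))) (sym (suc-2 (bound g) (+ j)))))
        where
        at-neg : ∀ j → 0ℚ ≡ at (pad 1 (digit g)) (ℤ.- + j)
        at-neg zero    = refl
        at-neg (suc j) = refl

  raise-* : ∀ n f g → raise n f * g ≋ f * g
  raise-* n f g = ≋-trans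
    (≋-digits (lem (bound f) (+ n) (bound g)) (conv-pad n (digit f) (digit g)))
    (≋-sym (≋-raise n (f * g)))
    where
    lem : ∀ b n c → b ℤ.+ n ℤ.+ c ≡ b ℤ.+ c ℤ.+ n
    lem = solve-∀

  -- Products are computed from representations. Padding `f` and `f′` with leading zeros up to a
  -- common bound makes their digits equal one by one, and padding a factor only pads the product.
  *-congˡ : ∀ {f f′} g → f ≋ f′ → f * g ≋ f′ * g
  *-congˡ {f} {f′} g p = ≋-trans (≋-sym (raise-* n f g))
    (≋-trans (≋-digits (cong (ℤ._+ bound g) bounds) (conv-cong digits λ _ → refl)) (raise-* n′ f′ g))
    where
    b = bound f ℤ.⊔ bound f′
    gap : ∀ {c} → c ℤ.≤ b → ∃[ n ] c ℤ.+ + n ≡ b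
    gap {c} c≤b with position b c
    ... | within j = j , lem b (+ j)
      where lem : ∀ b j → b ℤ.- j ℤ.+ j ≡ b
            lem = solve-∀
    ... | above j  = contradiction c≤b (ℤ.<⇒≱ (above-> b j))
    n  = proj₁ (gap (ℤ.i≤i⊔j (bound f) (bound f′)))
    n′ = proj₁ (gap (ℤ.i≤j⊔i (bound f) (bound f′)))
    bounds : bound (raise n f) ≡ bound (raise n′ f′)
    bounds = trans (proj₂ (gap (ℤ.i≤i⊔j (bound f) (bound f′)))) (sym (proj₂ (gap (ℤ.i≤j⊔i (bound f) (bound f′)))))
    digits : digit (raise n f) ≗ digit (raise n′ f′)
    digits j = begin
      digit (raise n f) j                              ≡⟨ coeff-within (raise n f) j ⟨
      coeff (raise n f) (bound (raise n f) ℤ.- + j)    ≡⟨ un≋ (≋-trans (≋-sym (≋-raise n f)) (≋-trans p (≋-raise n′ f′))) _ ⟩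
      coeff (raise n′ f′) (bound (raise n f) ℤ.- + j)  ≡⟨ cong (λ x → coeff (raise n′ f′) (x ℤ.- + j)) bounds ⟩
      coeff (raise n′ f′) (bound (raise n′ f′) ℤ.- + j) ≡⟨ coeff-within (raise n′ f′) j ⟩
      digit (raise n′ f′) j                            ∎
      where open ≡-Reasoning

  *-cong : ∀ {f f′ g g′} → f ≋ f′ → g ≋ g′ → f * g ≋ f′ * g′
  *-cong {f} {f′} {g} {g′} p q = ≋-trans (*-congˡ g p)
    (≋-trans (*-comm f′ g) (≋-trans (*-congˡ f′ q) (*-comm g′ f′)))

  *-distribʳ : ∀ h f g → (f + g) * h ≋ f * h + g * h
  *-distribʳ h f g = ≋-trans main (+-cong (*-congˡ h (≋-sym f≋)) (*-congˡ h (≋-sym g≋)))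
    where
    b  = bound f ℤ.⊔ bound g
    f≋ : f ≋ mkLaurent b (digitsFrom b f)
    f≋ = rebase (DegLe-mono (ℤ.i≤i⊔j (bound f) (bound g)) (DegLe-bound f))
    g≋ : g ≋ mkLaurent b (digitsFrom b g)
    g≋ = rebase (DegLe-mono (ℤ.i≤j⊔i (bound f) (bound g)) (DegLe-bound g))
    sum-same : ∀ c x y → mkLaurent c (λ j → x j ℚ.+ y j) ≋ mkLaurent c x + mkLaurent c y
    sum-same c x y = ≋-digits (sym (ℤ.⊔-idem c)) λ j →
      cong₂ ℚ._+_ (same x j) (same y j)
      where
      same : ∀ x j → x j ≡ at x (c ℤ.- (c ℤ.⊔ c ℤ.- + j))
      same x j = trans (sym (at-within x c j)) (cong (λ d → at x (c ℤ.- (d ℤ.- + j))) (sym (ℤ.⊔-idem c)))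
    main : (f + g) * h ≋ mkLaurent b (digitsFrom b f) * h + mkLaurent b (digitsFrom b g) * h
    -- The digits of `f + g` are by definition the sums of the rebased digits, so distributivity of
    -- `conv` applies at once.
    main = ≋-trans (≋-digits refl (conv-distribʳ (digitsFrom b f) (digitsFrom b g) (digit h)))
      (sum-same (b ℤ.+ bound h) _ _)

  const-+ : ∀ p q → const (p ℚ.+ q) ≋ const p + const q
  const-+ p q = ≋-digits refl λ { zero → refl ; (suc j) → refl }

  const-* : ∀ p q → const (p ℚ.* q) ≋ const p * const q
  const-* p q = ≋-digits refl λ n → trans (lem n) (sym (conv-leading p (leading q) n))
    where
    lem : ∀ n → leading (p ℚ.* q) n ≡ p ℚ.* leading q n
    lem zero    = refl
    lem (suc n) = sym (ℚ.*-zeroʳ p)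

  const-neg : ∀ p → const (ℚ.- p) ≋ - const p
  const-neg p = ≋-digits refl λ { zero → refl ; (suc j) → refl }

infixl 6 _+_ _-_
infixl 7 _*_
infix  8 -_

-- Opaque copies of the operations: conversion checking, notably in the ring
-- solver, must not unfold Cauchy products.
opaque
  _+_ _*_ : Laurent → Laurent → Laurent
  _+_ = Defs._+_
  _*_ = Defs._*_

  -_ : Laurent → Laurent
  -_ = Defs.-_

  const : ℚ → Laurent
  const = Defs.const

_-_ : Laurent → Laurent → Laurent
f - g = f + (- g)

0# 1# : Laurent
0# = const 0ℚ
1# = const 1ℚ

opaque
  unfolding _+_

  +-def : ∀ {f g} → f Defs.+ g ≋ f + g
  +-def = ≋-refl

  *-def : ∀ {f g} → f Defs.* g ≋ f * g
  *-def = ≋-refl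

  neg-def : ∀ {f} → Defs.- f ≋ - f
  neg-def = ≋-refl

  const-def : ∀ {q} → Defs.const q ≋ const q
  const-def = ≋-refl

  coeff-+ : ∀ f g k → coeff (f + g) k ≡ coeff f k ℚ.+ coeff g k
  coeff-+ = Raw.coeff-+

  coeff-neg : ∀ f k → coeff (- f) k ≡ ℚ.- coeff f k
  coeff-neg = Raw.coeff-neg

  coeff-0 : ∀ k → coeff 0# k ≡ 0ℚ
  coeff-0 = Raw.coeff-0

  coeff-const : ∀ a k → coeff (const a) (+ k) ≡ leading a k
  coeff-const a zero    = refl
  coeff-const a (suc k) = refl

  coeff-const-neg : ∀ a k → coeff (const a) -[1+ k ] ≡ 0ℚ
  coeff-const-neg a k = refl

  *-≋ : ∀ {d e a b f g} → f ≋ mkLaurent d a → g ≋ mkLaurent e b → f * g ≋ mkLaurent (d ℤ.+ e) (conv a b)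
  *-≋ p q = Raw.*-cong p q

  const-+ : ∀ p q → const (p ℚ.+ q) ≋ const p + const q
  const-+ = Raw.const-+

  const-* : ∀ p q → const (p ℚ.* q) ≋ const p * const q
  const-* = Raw.const-*

  const-neg : ∀ p → const (ℚ.- p) ≋ - const p
  const-neg = Raw.const-neg

  +-cong : ∀ {f f′ g g′} → f ≋ f′ → g ≋ g′ → f + g ≋ f′ + g′
  +-cong = Raw.+-cong

  *-cong : ∀ {f f′ g g′} → f ≋ f′ → g ≋ g′ → f * g ≋ f′ * g′
  *-cong = Raw.*-cong

  neg-cong : ∀ {f g} → f ≋ g → - f ≋ - g
  neg-cong = Raw.neg-cong

  +-assoc : ∀ f g h → f + g + h ≋ f + (g + h)
  +-assoc = Raw.+-assoc

  +-comm : ∀ f g → f + g ≋ g + f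
  +-comm = Raw.+-comm

  +-identityˡ : ∀ f → 0# + f ≋ f
  +-identityˡ = Raw.+-identityˡ

  neg-inverseˡ : ∀ f → - f + f ≋ 0#
  neg-inverseˡ = Raw.neg-inverseˡ

  *-comm : ∀ f g → f * g ≋ g * f
  *-comm = Raw.*-comm

  *-assoc : ∀ f g h → f * g * h ≋ f * (g * h)
  *-assoc = Raw.*-assoc

  *-identityˡ : ∀ f → 1# * f ≋ f
  *-identityˡ = Raw.*-identityˡ

  *-distribʳ : ∀ h f g → (f + g) * h ≋ f * h + g * h
  *-distribʳ = Raw.*-distribʳ

laurentRing : CommutativeRing 0ℓ 0ℓ
laurentRing = record
  { Carrier = Laurent ; _≈_ = _≋_ ; _+_ = _+_ ; _*_ = _*_ ; -_ = -_ ; 0# = 0# ; 1# = 1#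
  ; isCommutativeRing = record
    { isRing = record
      { +-isAbelianGroup = record
        { isGroup = record
          { isMonoid = record
            { isSemigroup = record
              { isMagma = record
                { isEquivalence = record { refl = ≋-refl ; sym = ≋-sym ; trans = ≋-trans }
                ; ∙-cong = +-cong }
              ; assoc = +-assoc }
            ; identity = +-identityˡ , λ f → ≋-trans (+-comm f 0#) (+-identityˡ f) }
          ; inverse = neg-inverseˡ , (λ f → ≋-trans (+-comm f (- f)) (neg-inverseˡ f))
          ; ⁻¹-cong = neg-cong }
        ; comm = +-comm }
      ; *-cong = *-cong
      ; *-assoc = *-assoc
      ; *-identity = *-identityˡ , λ f → ≋-trans (*-comm f 1#) (*-identityˡ f)
      ; distrib = (λ h f g → ≋-trans (*-comm h (f + g))
          (≋-trans (*-distribʳ h f g) (+-cong (*-comm f h) (*-comm g h)))) , *-distribʳ }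
    ; *-comm = *-comm } }

open CommutativeRing laurentRing
  using (*-identityʳ) renaming (setoid to laurentSetoid; zeroˡ to *-zeroˡ; zeroʳ to *-zeroʳ)

*-congˡ : ∀ {f f′} g → f ≋ f′ → f * g ≋ f′ * g
*-congˡ g p = *-cong p (≋-refl {g})

-- The ring solver takes rational constants as coefficients: they can be compared, which series
-- cannot, and they include ½ and ¼.
weakly≟ : ∀ p q → Maybe (const p ≋ const q)
weakly≟ p q with p ℚ.≟ q
... | yes refl = just ≋-refl
... | no _     = nothing

constMorphism : CommutativeRing.rawRing ℚ.+-*-commutativeRing -Raw-AlmostCommutative⟶ fromCommutativeRing laurentRing
constMorphism = record
  { ⟦_⟧ = const ; +-homo = const-+ ; *-homo = const-* ; -‿homo = const-neg
  ; 0-homo = ≋-refl ; 1-homo = ≋-refl }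

module LaurentSolver = RingSolver (CommutativeRing.rawRing ℚ.+-*-commutativeRing)
  (fromCommutativeRing laurentRing) constMorphism weakly≟

module ≋-Reasoning = SetoidReasoning laurentSetoid

-- Degrees

DegLe-0 : ∀ {d} → DegLe 0# d
DegLe-0 = degLe λ k _ → coeff-0 k

DegLe-+ : ∀ {f g d} → DegLe f d → DegLe g d → DegLe (f + g) d
DegLe-+ {f} {g} (degLe p) (degLe q) = degLe λ k d<k →
  trans (coeff-+ f g k) (cong₂ ℚ._+_ (p k d<k) (q k d<k))

DegLe-neg : ∀ {f d} → DegLe f d → DegLe (- f) d
DegLe-neg {f} (degLe p) = degLe λ k d<k → trans (coeff-neg f k) (cong ℚ.-_ (p k d<k))

*-rebase : ∀ {f g d e} → DegLe f d → DegLe g e →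
  f * g ≋ mkLaurent (d ℤ.+ e) (conv (digitsFrom d f) (digitsFrom e g))
*-rebase p q = *-≋ (rebase p) (rebase q)

DegLe-* : ∀ {f g d e} → DegLe f d → DegLe g e → DegLe (f * g) (d ℤ.+ e)
DegLe-* p q = DegLe-cong (≋-sym (*-rebase p q)) (DegLe-bound _)

coeff-*-top : ∀ {f g d e} → DegLe f d → DegLe g e → coeff (f * g) (d ℤ.+ e) ≡ coeff f d ℚ.* coeff g e
coeff-*-top {f} {g} {d} {e} p q = begin
  coeff (f * g) (d ℤ.+ e)             ≡⟨ un≋ (*-rebase p q) (d ℤ.+ e) ⟩
  at _ (d ℤ.+ e ℤ.- (d ℤ.+ e))        ≡⟨ cong (at _) (ℤ.i≡j⇒i-j≡0 {d ℤ.+ e} refl) ⟩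
  digitsFrom d f 0 ℚ.* digitsFrom e g 0 ℚ.+ 0ℚ  ≡⟨ ℚ.+-identityʳ _ ⟩
  digitsFrom d f 0 ℚ.* digitsFrom e g 0
    ≡⟨ cong₂ (λ x y → coeff f x ℚ.* coeff g y) (ℤ.+-identityʳ d) (ℤ.+-identityʳ e) ⟩
  coeff f d ℚ.* coeff g e             ∎
  where open ≡-Reasoning

record Deg (f : Laurent) (d : ℤ) : Set where
  constructor mkDeg
  field
    top≢0 : coeff f d ≢ 0ℚ
    Deg⇒DegLe : DegLe f d
open Deg

toDeg : ∀ f {d} → IsDeg f [ d ] → Deg f d
toDeg f (c≢0 , v) = mkDeg c≢0 (degLe v)

fromDeg : ∀ f {d} → Deg f d → IsDeg f [ d ]
fromDeg f (mkDeg c≢0 (degLe v)) = c≢0 , v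

Deg-minimal : ∀ {f d e} → Deg f d → DegLe f e → d ℤ.≤ e
Deg-minimal f-deg (degLe v) = ℤ.≮⇒≥ λ e<d → top≢0 f-deg (v _ e<d)

Deg-unique : ∀ {f d e} → Deg f d → Deg f e → d ≡ e
Deg-unique p q = ℤ.≤-antisym (Deg-minimal p (Deg⇒DegLe q)) (Deg-minimal q (Deg⇒DegLe p))

Deg-cong : ∀ {f g d} → f ≋ g → Deg f d → Deg g d
Deg-cong e (mkDeg c≢0 v) = mkDeg (λ c≡0 → c≢0 (trans (un≋ e _) c≡0)) (DegLe-cong e v)

Deg⇒≉0 : ∀ {f d} → Deg f d → ¬ (f ≋ 0#)
Deg⇒≉0 {d = d} f-deg (mk≋ z) = top≢0 f-deg (trans (z d) (coeff-0 d))

lower : ∀ {f d} → DegLe f d → coeff f d ≡ 0ℚ → DegLe f (d ℤ.- + 1)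
lower {f} {d} (degLe v) z = degLe w
  where
  w : ∀ k → d ℤ.- + 1 ℤ.< k → coeff f k ≡ 0ℚ
  w k d-1<k with d ℤ.≟ k
  ... | yes refl = z
  ... | no d≢k   = v k (ℤ.≤∧≢⇒< (subst (ℤ._≤ k) (lem d) (ℤ.i<j⇒suc[i]≤j d-1<k)) d≢k)
    where lem : ∀ d → + 1 ℤ.+ (d ℤ.- + 1) ≡ d
          lem = solve-∀

≋0 : ∀ {f} d → (∀ n → DegLe f (d ℤ.- + n)) → f ≋ 0#
≋0 {f} d v = mk≋ λ k → trans (z k) (sym (coeff-0 k))
  where
  z : ∀ k → coeff f k ≡ 0ℚ
  z k with position d k
  ... | within j = vanish (v (suc j)) _ (ℤ.+-monoʳ-< d (ℤ.neg-mono-< (ℤ.+<+ (ℕ.n<1+n j))))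
  ... | above j  = vanish (v 0) _ (subst (ℤ._< d ℤ.+ + suc j) (sym (ℤ.+-identityʳ d)) (above-> d j))

inverseℚ : ∀ p → p ≢ 0ℚ → ∃[ q ] q ℚ.* p ≡ 1ℚ
inverseℚ p p≢0 = ℚ.1/_ p {{ℚ.≢-nonZero p≢0}} , ℚ.*-inverseˡ p {{ℚ.≢-nonZero p≢0}}

*-nonzero : ∀ {p q} → p ≢ 0ℚ → p ℚ.* q ≡ 0ℚ → q ≡ 0ℚ
*-nonzero {p} {q} p≢0 pq≡0 with r , rp≡1 ← inverseℚ p p≢0 = begin
  q                ≡⟨ ℚ.*-identityˡ q ⟨
  1ℚ ℚ.* q         ≡⟨ cong (ℚ._* q) rp≡1 ⟨
  r ℚ.* p ℚ.* q    ≡⟨ ℚ.*-assoc r p q ⟩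
  r ℚ.* (p ℚ.* q)  ≡⟨ cong (r ℚ.*_) pq≡0 ⟩
  r ℚ.* 0ℚ         ≡⟨ ℚ.*-zeroʳ r ⟩
  0ℚ               ∎
  where open ≡-Reasoning

Deg-* : ∀ {f g d e} → Deg f d → Deg g e → Deg (f * g) (d ℤ.+ e)
Deg-* (mkDeg c≢0 p) (mkDeg c′≢0 q) =
  mkDeg (λ z → c′≢0 (*-nonzero c≢0 (trans (sym (coeff-*-top p q)) z))) (DegLe-* p q)

-- Digit `n` of the product of `a` and `y` is `a 0` times `y n` plus `rest y n`, which involves only
-- earlier digits of `y`. Setting it equal to digit `n` of 1 and dividing by `a 0` gives a causal
-- recursion for `y`.
module _ (a : Seq) (a₀≢0 : a 0 ≢ 0ℚ) where
  private
    r = proj₁ (inverseℚ (a 0) a₀≢0)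

    rest : Seq → Seq
    rest y zero    = 0ℚ
    rest y (suc n) = conv (a ∘ suc) y n

    rest-causal : ∀ y z n → (∀ i → i ℕ.< n → y i ≡ z i) → rest y n ≡ rest z n
    rest-causal y z zero    _ = refl
    rest-causal y z (suc n) e = conv-local {a = a ∘ suc} n (λ _ _ → refl) (λ i i≤n → e i (s≤s i≤n))

    conv-rest : ∀ y n → conv a y n ≡ a 0 ℚ.* y n ℚ.+ rest y n
    conv-rest y zero    = refl
    conv-rest y (suc n) = refl

    open Recursion (λ y n → r ℚ.* (leading 1ℚ n ℚ.- rest y n))
      (λ y z n e → cong (λ x → r ℚ.* (leading 1ℚ n ℚ.- x)) (rest-causal y z n e))

  reciprocal : Seq
  reciprocal = fix

  conv-reciprocal : conv a reciprocal ≗ leading 1ℚ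
  conv-reciprocal n = begin
    conv a fix n                                    ≡⟨ conv-rest fix n ⟩
    a 0 ℚ.* fix n ℚ.+ rest fix n                    ≡⟨ cong (λ x → a 0 ℚ.* x ℚ.+ rest fix n) (fix-eq n) ⟩
    a 0 ℚ.* (r ℚ.* (leading 1ℚ n ℚ.- rest fix n)) ℚ.+ rest fix n
      ≡⟨ solve 4 (λ x r l t → x :* (r :* (l :- t)) :+ t := r :* x :* (l :- t) :+ t) refl
           (a 0) r (leading 1ℚ n) (rest fix n) ⟩
    r ℚ.* a 0 ℚ.* (leading 1ℚ n ℚ.- rest fix n) ℚ.+ rest fix n
      ≡⟨ cong (λ x → x ℚ.* (leading 1ℚ n ℚ.- rest fix n) ℚ.+ rest fix n) (proj₂ (inverseℚ (a 0) a₀≢0)) ⟩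
    1ℚ ℚ.* (leading 1ℚ n ℚ.- rest fix n) ℚ.+ rest fix n
      ≡⟨ solve 2 (λ l t → con 1ℚ :* (l :- t) :+ t := l) refl (leading 1ℚ n) (rest fix n) ⟩
    leading 1ℚ n                                    ∎
    where open ≡-Reasoning
          open +-*-Solver

open LaurentSolver using (solve; con; _:=_; _:+_; _:*_; _:-_; :-_)

inverse : ∀ {f d} → Deg f d → ∃[ g ] f * g ≋ 1# × DegLe g (ℤ.- d)
inverse {f} {d} f-deg = g , ≋-trans (*-≋ (rebase (Deg⇒DegLe f-deg)) ≋-refl)
    (≋-trans (≋-digits (ℤ.+-inverseʳ d) (conv-reciprocal (digitsFrom d f) a₀≢0)) const-def) , DegLe-bound g
  where
  a₀≢0 : digitsFrom d f 0 ≢ 0ℚ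
  a₀≢0 z = top≢0 f-deg (trans (cong (coeff f) (sym (ℤ.+-identityʳ d))) z)
  g = mkLaurent (ℤ.- d) (reciprocal (digitsFrom d f) a₀≢0)

inverse-unique : ∀ {f g h} → f * g ≋ 1# → f * h ≋ 1# → g ≋ h
inverse-unique {f} {g} {h} fg fh = begin
  g            ≈⟨ solve 1 (λ g → g := con 1ℚ :* g) ≋-refl g ⟩
  1# * g       ≈⟨ *-congˡ g fh ⟨
  f * h * g    ≈⟨ solve 3 (λ f g h → f :* h :* g := f :* g :* h) ≋-refl f g h ⟩
  f * g * h    ≈⟨ *-congˡ h fg ⟩
  1# * h       ≈⟨ *-identityˡ h ⟩
  h            ∎
  where open ≋-Reasoning

-- A continued fraction comes with some reciprocal, of which nothing else is known. Uniqueness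
-- identifies it with the constructed one, whose bound is known.
inverse-DegLe : ∀ {f g d} → Deg f d → f * g ≋ 1# → DegLe g (ℤ.- d)
inverse-DegLe f-deg fg =
  let _ , fh , h-deg = inverse f-deg in DegLe-cong (inverse-unique fh fg) h-deg

coeff-monomial-* : ∀ q n f k → coeff (monomial q n * f) k ≡ q ℚ.* coeff f (k ℤ.- n)
coeff-monomial-* q n f k = begin
  coeff (monomial q n * f) k
    ≡⟨ un≋ (≋-trans (*-≋ (≋-refl {monomial q n}) (≋-refl {f})) (≋-digits refl (conv-leading q (digit f)))) k ⟩
  at (λ j → q ℚ.* digit f j) (n ℤ.+ bound f ℤ.- k)      ≡⟨ at-scale (n ℤ.+ bound f ℤ.- k) ⟩
  q ℚ.* at (digit f) (n ℤ.+ bound f ℤ.- k)              ≡⟨ cong (λ i → q ℚ.* at (digit f) i) (lem n (bound f) k) ⟩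
  q ℚ.* coeff f (k ℤ.- n)                               ∎
  where
  open ≡-Reasoning
  at-scale : ∀ i → at (λ j → q ℚ.* digit f j) i ≡ q ℚ.* at (digit f) i
  at-scale (+ j)    = refl
  at-scale -[1+ j ] = sym (ℚ.*-zeroʳ q)
  lem : ∀ n b k → n ℤ.+ b ℤ.- k ≡ b ℤ.- (k ℤ.- n)
  lem = solve-∀

coeff-T* : ∀ f k → coeff (T * f) k ≡ coeff f (k ℤ.- + 1)
coeff-T* f k = trans (coeff-monomial-* 1ℚ (+ 1) f k) (ℚ.*-identityˡ _)

Deg-monomial : ∀ {q} n → q ≢ 0ℚ → Deg (monomial q n) n
Deg-monomial {q} n q≢0 = mkDeg
  (λ z → q≢0 (trans (cong (at (leading q)) (sym (ℤ.i≡j⇒i-j≡0 {n} refl))) z)) (DegLe-bound (monomial q n))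

-- Polynomials

nth : Poly → Seq
nth []      _       = 0ℚ
nth (a ∷ p) zero    = a
nth (a ∷ p) (suc k) = nth p k

⟦⟧-[] : ⟦ [] ⟧ ≋ 0#
⟦⟧-[] = const-def

⟦⟧-∷ : ∀ a p → ⟦ a ∷ p ⟧ ≋ const a + T * ⟦ p ⟧
⟦⟧-∷ a p = ≋-trans +-def (+-cong const-def *-def)

coeff-neg-⟦⟧ : ∀ p k → coeff ⟦ p ⟧ -[1+ k ] ≡ 0ℚ
coeff-neg-⟦⟧ []      k = refl
coeff-neg-⟦⟧ (a ∷ p) k = begin
  coeff ⟦ a ∷ p ⟧ -[1+ k ]                                   ≡⟨ un≋ (⟦⟧-∷ a p) -[1+ k ] ⟩
  coeff (const a + T * ⟦ p ⟧) -[1+ k ]                       ≡⟨ coeff-+ (const a) (T * ⟦ p ⟧) -[1+ k ] ⟩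
  coeff (const a) -[1+ k ] ℚ.+ coeff (T * ⟦ p ⟧) -[1+ k ]
    ≡⟨ cong₂ ℚ._+_ (coeff-const-neg a k) (trans (coeff-T* ⟦ p ⟧ -[1+ k ]) (coeff-neg-⟦⟧ p _)) ⟩
  0ℚ                                                         ∎
  where open ≡-Reasoning

coeff-⟦⟧ : ∀ p k → coeff ⟦ p ⟧ (+ k) ≡ nth p k
coeff-⟦⟧ []      k       = trans (un≋ ⟦⟧-[] (+ k)) (coeff-0 (+ k))
coeff-⟦⟧ (a ∷ p) k = begin
  coeff ⟦ a ∷ p ⟧ (+ k)                                ≡⟨ un≋ (⟦⟧-∷ a p) (+ k) ⟩
  coeff (const a + T * ⟦ p ⟧) (+ k)                    ≡⟨ coeff-+ (const a) (T * ⟦ p ⟧) (+ k) ⟩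
  coeff (const a) (+ k) ℚ.+ coeff (T * ⟦ p ⟧) (+ k)    ≡⟨ cong₂ ℚ._+_ (coeff-const a k) (coeff-T* ⟦ p ⟧ (+ k)) ⟩
  leading a k ℚ.+ coeff ⟦ p ⟧ (+ k ℤ.- + 1)            ≡⟨ split k ⟩
  nth (a ∷ p) k                                        ∎
  where
  open ≡-Reasoning
  split : ∀ k → leading a k ℚ.+ coeff ⟦ p ⟧ (+ k ℤ.- + 1) ≡ nth (a ∷ p) k
  split zero    = trans (cong (a ℚ.+_) (coeff-neg-⟦⟧ p 0)) (ℚ.+-identityʳ a)
  split (suc k) = trans (ℚ.+-identityˡ _) (coeff-⟦⟧ p k)

-- Being equal to a polynomial, rather than being a coefficient list, lets sums and products be
-- formed in the ring of series, where the solver works.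
IsPoly : Laurent → Set
IsPoly f = ∃[ p ] ⟦ p ⟧ ≋ f

IsPoly-⟦⟧ : ∀ p → IsPoly ⟦ p ⟧
IsPoly-⟦⟧ p = p , ≋-refl

IsPoly-cong : ∀ {f g} → f ≋ g → IsPoly f → IsPoly g
IsPoly-cong e (p , q) = p , ≋-trans q e

IsPoly-vanish : ∀ {f} → IsPoly f → ∀ k → k ℤ.< + 0 → coeff f k ≡ 0ℚ
IsPoly-vanish (p , e) -[1+ k ] _ = trans (sym (un≋ e -[1+ k ])) (coeff-neg-⟦⟧ p k)
IsPoly-vanish (p , e) (+ k) (ℤ.+<+ ())

IsPoly-∷ : ∀ {f} a → IsPoly f → IsPoly (const a + T * f)
IsPoly-∷ {f} a (p , e) = a ∷ p , ≋-trans (⟦⟧-∷ a p) (+-cong (≋-refl {const a}) (*-cong (≋-refl {T}) e))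

IsPoly-0 : IsPoly 0#
IsPoly-0 = [] , ⟦⟧-[]

IsPoly-const : ∀ a → IsPoly (const a)
IsPoly-const a = IsPoly-cong
  (solve 2 (λ a t → a :+ t :* con 0ℚ := a) ≋-refl (const a) T) (IsPoly-∷ a IsPoly-0)

IsPoly-+ : ∀ {f g} → IsPoly f → IsPoly g → IsPoly (f + g)
IsPoly-+ (p , e) (q , e′) = IsPoly-cong (+-cong e e′) (go p q)
  where
  go : ∀ p q → IsPoly (⟦ p ⟧ + ⟦ q ⟧)
  go []      q       = q , ≋-trans (solve 1 (λ q → q := con 0ℚ :+ q) ≋-refl ⟦ q ⟧) (+-cong (≋-sym ⟦⟧-[]) ≋-refl)
  go (a ∷ p) []      = a ∷ p , ≋-trans (solve 1 (λ q → q := q :+ con 0ℚ) ≋-refl ⟦ a ∷ p ⟧) (+-cong ≋-refl (≋-sym ⟦⟧-[]))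
  go (a ∷ p) (b ∷ q) = IsPoly-cong (begin
    const (a ℚ.+ b) + T * (⟦ p ⟧ + ⟦ q ⟧)           ≈⟨ +-cong (const-+ a b) ≋-refl ⟩
    const a + const b + T * (⟦ p ⟧ + ⟦ q ⟧)         ≈⟨ solve 5 (λ a b t p q →
                                                         a :+ b :+ t :* (p :+ q) := a :+ t :* p :+ (b :+ t :* q))
                                                         ≋-refl (const a) (const b) T ⟦ p ⟧ ⟦ q ⟧ ⟩
    const a + T * ⟦ p ⟧ + (const b + T * ⟦ q ⟧)     ≈⟨ +-cong (⟦⟧-∷ a p) (⟦⟧-∷ b q) ⟨
    ⟦ a ∷ p ⟧ + ⟦ b ∷ q ⟧                           ∎)
    (IsPoly-∷ (a ℚ.+ b) (go p q))
    where open ≋-Reasoning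

IsPoly-T* : ∀ {f} → IsPoly f → IsPoly (T * f)
IsPoly-T* {f} p = IsPoly-cong (solve 2 (λ t f → con 0ℚ :+ t :* f := t :* f) ≋-refl T f) (IsPoly-∷ 0ℚ p)

IsPoly-T : IsPoly T
IsPoly-T = IsPoly-cong (*-identityʳ T) (IsPoly-T* (IsPoly-const 1ℚ))

IsPoly-const* : ∀ {f} a → IsPoly f → IsPoly (const a * f)
IsPoly-const* a (p , e) = IsPoly-cong (*-cong (≋-refl {const a}) e) (go p)
  where
  go : ∀ p → IsPoly (const a * ⟦ p ⟧)
  go []      = IsPoly-cong (≋-trans (≋-sym (*-zeroʳ (const a))) (*-cong ≋-refl (≋-sym ⟦⟧-[]))) IsPoly-0
  go (b ∷ p) = IsPoly-cong (begin
    const (a ℚ.* b) + T * (const a * ⟦ p ⟧)     ≈⟨ +-cong (const-* a b) ≋-refl ⟩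
    const a * const b + T * (const a * ⟦ p ⟧)
      ≈⟨ solve 4 (λ a b t p → a :* b :+ t :* (a :* p) := a :* (b :+ t :* p)) ≋-refl (const a) (const b) T ⟦ p ⟧ ⟩
    const a * (const b + T * ⟦ p ⟧)             ≈⟨ *-cong ≋-refl (⟦⟧-∷ b p) ⟨
    const a * ⟦ b ∷ p ⟧                         ∎)
    (IsPoly-∷ (a ℚ.* b) (go p))
    where open ≋-Reasoning

IsPoly-* : ∀ {f g} → IsPoly f → IsPoly g → IsPoly (f * g)
IsPoly-* {f} {g} (p , e) g-poly = IsPoly-cong (*-congˡ g e) (go p)
  where
  go : ∀ p → IsPoly (⟦ p ⟧ * g)
  go []      = IsPoly-cong (≋-trans (≋-sym (*-zeroˡ g)) (*-congˡ g (≋-sym ⟦⟧-[]))) IsPoly-0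
  go (a ∷ p) = IsPoly-cong (begin
    const a * g + T * (⟦ p ⟧ * g)
      ≈⟨ solve 4 (λ a t p g → a :* g :+ t :* (p :* g) := (a :+ t :* p) :* g) ≋-refl (const a) T ⟦ p ⟧ g ⟩
    (const a + T * ⟦ p ⟧) * g        ≈⟨ *-congˡ g (⟦⟧-∷ a p) ⟨
    ⟦ a ∷ p ⟧ * g                    ∎)
    (IsPoly-+ (IsPoly-const* a g-poly) (IsPoly-T* (go p)))
    where open ≋-Reasoning

poly-part : ∀ f → ∃[ p ] DegLe (f - ⟦ p ⟧) (ℤ.- + 1)
poly-part f = p , degLe v
  where
  tabulate : ℕ → Seq → Poly
  tabulate zero    a = []
  tabulate (suc n) a = a 0 ∷ tabulate n (a ∘ suc)
  nth-tabulate : ∀ n a k → (n ℕ.≤ k → a k ≡ 0ℚ) → nth (tabulate n a) k ≡ a k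
  nth-tabulate zero    a k       z = sym (z z≤n)
  nth-tabulate (suc n) a zero    z = refl
  nth-tabulate (suc n) a (suc k) z = nth-tabulate n (a ∘ suc) k λ n≤k → z (s≤s n≤k)
  -- Exponents from `N` on exceed `bound f`, so the truncation at this length loses nothing.
  N = suc ℤ.∣ bound f ∣
  p = tabulate N (λ k → coeff f (+ k))
  high : ∀ k → N ℕ.≤ k → coeff f (+ k) ≡ 0ℚ
  high k N≤k = coeff-above f (ℤ.≤-<-trans (i≤∣i∣ (bound f)) (ℤ.+<+ N≤k))
    where
    i≤∣i∣ : ∀ i → i ℤ.≤ + ℤ.∣ i ∣
    i≤∣i∣ (+ n)    = ℤ.≤-refl
    i≤∣i∣ -[1+ n ] = ℤ.-≤+
  v : ∀ k → ℤ.- + 1 ℤ.< k → coeff (f - ⟦ p ⟧) k ≡ 0ℚ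
  v -[1+ k ] (ℤ.-<- ())
  v (+ k)    _ = begin
    coeff (f - ⟦ p ⟧) (+ k)                     ≡⟨ coeff-+ f (- ⟦ p ⟧) (+ k) ⟩
    coeff f (+ k) ℚ.+ coeff (- ⟦ p ⟧) (+ k)     ≡⟨ cong (coeff f (+ k) ℚ.+_) (coeff-neg ⟦ p ⟧ (+ k)) ⟩
    coeff f (+ k) ℚ.- coeff ⟦ p ⟧ (+ k)
      ≡⟨ cong (λ x → coeff f (+ k) ℚ.- x) (trans (coeff-⟦⟧ p k) (nth-tabulate N (λ k → coeff f (+ k)) k (high k))) ⟩
    coeff f (+ k) ℚ.- coeff f (+ k)             ≡⟨ ℚ.+-inverseʳ (coeff f (+ k)) ⟩
    0ℚ                                          ∎
    where open ≡-Reasoning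

-- Continued fractions

Deg-+ˡ : ∀ {f g d e} → Deg f d → DegLe g e → e ℤ.< d → Deg (f + g) d
Deg-+ˡ {f} {g} {d} f-deg g-deg e<d = mkDeg
  (λ z → top≢0 f-deg (trans (sym (ℚ.+-identityʳ _))
    (trans (cong (coeff f d ℚ.+_) (sym (vanish g-deg d e<d))) (trans (sym (coeff-+ f g d)) z))))
  (DegLe-+ (Deg⇒DegLe f-deg) (DegLe-mono (ℤ.<⇒≤ e<d) g-deg))

Deg-near : ∀ {f g d} → Deg f d → + 1 ℤ.≤ d → DegLe (g - f) (ℤ.- + 1) → Deg g d
Deg-near {f} {g} f-deg 1≤d near = Deg-cong (solve 2 (λ f g → f :+ (g :- f) := g) ≋-refl f g)
  (Deg-+ˡ f-deg near (ℤ.<-≤-trans ℤ.-<+ 1≤d))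

≋-difference : ∀ {f g d} → f ≋ g → DegLe (f - g) d
≋-difference {f} {g} e = DegLe-cong
  (≋-trans (solve 1 (λ g → con 0ℚ := g :- g) ≋-refl g) (+-cong (≋-sym e) ≋-refl)) DegLe-0

coeff-agree : ∀ {f g d} → DegLe (f - g) d → ∀ k → d ℤ.< k → coeff f k ≡ coeff g k
coeff-agree {f} {g} e k d<k = begin
  coeff f k                          ≡⟨ un≋ (solve 2 (λ f g → f := (f :- g) :+ g) ≋-refl f g) k ⟩
  coeff (f - g + g) k                ≡⟨ coeff-+ (f - g) g k ⟩
  coeff (f - g) k ℚ.+ coeff g k      ≡⟨ cong (ℚ._+ coeff g k) (vanish e k d<k) ⟩
  0ℚ ℚ.+ coeff g k                   ≡⟨ ℚ.+-identityˡ _ ⟩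
  coeff g k                          ∎
  where open ≡-Reasoning

DegLe-flip : ∀ {f g d} → DegLe (f - g) d → DegLe (g - f) d
DegLe-flip {f} {g} p = DegLe-cong (solve 2 (λ f g → :- (f :- g) := g :- f) ≋-refl f g) (DegLe-neg p)

inverse-small : ∀ {x y d} → Deg x d → + 1 ℤ.≤ d → x * y ≋ 1# → DegLe y (ℤ.- + 1)
inverse-small x-deg 1≤d xy = DegLe-mono (ℤ.neg-mono-≤ 1≤d) (inverse-DegLe x-deg xy)

-- The head is exempt because `leftOf` starts with the zero polynomial.
TailPositive : (ℕ → Poly) → Set
TailPositive c = ∀ n → PositiveDegree (c (suc n))

-- Mutual induction: a denominator is within degree -1 of its own head, which has degree at least 1,
-- so it shares that degree and its reciprocal has degree at most -1.
fraction-small : ∀ c n {f} → TailPositive c → FiniteCF c n f → DegLe (f - ⟦ c 0 ⟧) (ℤ.- + 1)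
denominator-deg : ∀ c n {x} → TailPositive c → FiniteCF (c ∘ suc) n x → ∃[ d ] (+ 1 ℤ.≤ d × Deg x d)

fraction-small c zero    pos e = ≋-difference (mk≋ e)
fraction-small c (suc n) {f} pos (x , y , x-cf , xy , e) =
  let d , 1≤d , x-deg = denominator-deg c n pos x-cf
  in DegLe-cong
    (≋-trans (solve 2 (λ c y → y := c :+ y :- c) ≋-refl ⟦ c 0 ⟧ y)
      (+-cong (≋-sym (≋-trans (mk≋ e) +-def)) ≋-refl))
    (inverse-small x-deg 1≤d (≋-trans (≋-sym *-def) (≋-trans (mk≋ xy) const-def)))

denominator-deg c n pos x-cf =
  let d , 1≤d , c-deg = pos 0
  in d , 1≤d , Deg-near (toDeg ⟦ c 1 ⟧ c-deg) 1≤d (fraction-small (c ∘ suc) n (pos ∘ suc) x-cf)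

convergent : ∀ c n → TailPositive c → ∃[ f ] FiniteCF c n f
convergent c zero    pos = ⟦ c 0 ⟧ , λ _ → refl
convergent c (suc n) pos =
  let x , x-cf = convergent (c ∘ suc) n (pos ∘ suc)
      d , 1≤d , x-deg = denominator-deg c n pos x-cf
      y , xy , _ = inverse x-deg
  in ⟦ c 0 ⟧ Defs.+ y , x , y , x-cf , un≋ (≋-trans *-def (≋-trans xy (≋-sym const-def))) , λ _ → refl

-- For equal heads the difference is y - y′ = (x′ - x) y y′. As both reciprocals have degree at most
-- -1, each level of the fraction gains two degrees; the bound records one per level, which suffices
-- for convergence.
convergents-close : ∀ c {n m f g} → n ℕ.≤ m → TailPositive c → FiniteCF c n f → FiniteCF c m g →
  DegLe (f - g) -[1+ n ]
convergents-close c {m = m} {f} {g} z≤n pos e g-cf = DegLe-cong (+-cong (≋-sym (mk≋ e)) ≋-refl)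
  (DegLe-flip (fraction-small c m pos g-cf))
convergents-close c {f = f} {g} (s≤s {n} {m} n≤m) pos (x , y , x-cf , xy , e) (x′ , y′ , x′-cf , xy′ , e′) =
  let d  , 1≤d  , x-deg  = denominator-deg c n pos x-cf
      d′ , 1≤d′ , x′-deg = denominator-deg c m pos x′-cf
      xy≋1   = ≋-trans (≋-sym *-def) (≋-trans (mk≋ xy) const-def)
      x′y′≋1 = ≋-trans (≋-sym *-def) (≋-trans (mk≋ xy′) const-def)
  in DegLe-cong (begin
    (x′ - x) * y * y′
      ≈⟨ solve 4 (λ x y x′ y′ → (x′ :- x) :* y :* y′ := y :* (x′ :* y′) :- y′ :* (x :* y)) ≋-refl x y x′ y′ ⟩
    y * (x′ * y′) - y′ * (x * y)   ≈⟨ +-cong (*-cong ≋-refl x′y′≋1) (neg-cong (*-cong ≋-refl xy≋1)) ⟩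
    y * 1# - y′ * 1#
      ≈⟨ solve 3 (λ c y y′ → y :* con 1ℚ :- y′ :* con 1ℚ := c :+ y :- (c :+ y′)) ≋-refl ⟦ c 0 ⟧ y y′ ⟩
    ⟦ c 0 ⟧ + y - (⟦ c 0 ⟧ + y′)
      ≈⟨ +-cong (≋-trans (mk≋ e) +-def) (neg-cong (≋-trans (mk≋ e′) +-def)) ⟨
    f - g ∎)
    (DegLe-mono bound-≤ (DegLe-* (DegLe-* (DegLe-flip
      (convergents-close (c ∘ suc) n≤m (pos ∘ suc) x-cf x′-cf)) (inverse-small x-deg 1≤d xy≋1))
      (inverse-small x′-deg 1≤d′ x′y′≋1)))
  where
  open ≋-Reasoning
  bound-≤ : -[1+ n ] ℤ.+ ℤ.- + 1 ℤ.+ ℤ.- + 1 ℤ.≤ -[1+ suc n ]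
  bound-≤ = ℤ.-≤- (s≤s (ℕ.≤-trans (ℕ.m≤m+n n 0) (ℕ.≤-trans (ℕ.n≤1+n _) (ℕ.m≤m+n _ 0))))

-i≤∣i∣ : ∀ i → ℤ.- + ℤ.∣ i ∣ ℤ.≤ i
-i≤∣i∣ (+ zero)  = ℤ.≤-refl
-i≤∣i∣ (+ suc n) = ℤ.-≤+
-i≤∣i∣ -[1+ n ]  = ℤ.≤-refl

-[1+]<- : ∀ n → -[1+ n ] ℤ.< ℤ.- + n
-[1+]<- zero    = ℤ.-<+
-[1+]<- (suc n) = ℤ.-<- (ℕ.n<1+n n)

cf-exists : ∀ c → TailPositive c → ∃[ f ] IsCF c f
cf-exists c pos = f , h , h-cf , converges
  where
  h : ℕ → Laurent
  h n = proj₁ (convergent c n pos)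
  h-cf : ∀ n → FiniteCF c n (h n)
  h-cf n = proj₂ (convergent c n pos)
  B : ℤ
  -- With `B` at least 0 the exponent `B - i` is at least `-i`, where all convergents from index `i`
  -- on agree. Hence digit `i` of the limit may be read off from `h i`.
  B = bound ⟦ c 0 ⟧ ℤ.⊔ + 0
  h-deg : ∀ n → DegLe (h n) B
  h-deg n = DegLe-cong (solve 2 (λ h c → c :+ (h :- c) := h) ≋-refl (h n) ⟦ c 0 ⟧)
    (DegLe-+ (DegLe-mono (ℤ.i≤i⊔j _ _) (DegLe-bound ⟦ c 0 ⟧))
      (DegLe-mono (ℤ.≤-trans ℤ.-≤+ (ℤ.i≤j⊔i (bound ⟦ c 0 ⟧) (+ 0))) (fraction-small c n pos (h-cf n))))
  f : Laurent
  f = mkLaurent B λ j → coeff (h j) (B ℤ.- + j)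
  agree : ∀ {m n} k → m ℕ.≤ n → ℤ.- + m ℤ.≤ k → coeff (h n) k ≡ coeff (h m) k
  agree {m} {n} k m≤n -m≤k = sym (coeff-agree (convergents-close c m≤n pos (h-cf m) (h-cf n)) k
    (ℤ.<-≤-trans (-[1+]<- m) -m≤k))
  converges : h ⟶ f
  -- Exponents from `k` on are at least `- ∣ k ∣`, and there all convergents from index `∣ k ∣` on
  -- agree.
  converges k = ℤ.∣ k ∣ , λ n N≤n j k≤j → go n N≤n j k≤j (position B j)
    where
    go : ∀ n → ℤ.∣ k ∣ ℕ.≤ n → ∀ j → k ℤ.≤ j → Position B j → coeff (h n) j ≡ coeff f j
    go n N≤n .(B ℤ.+ + suc i) k≤j (above i) =
      trans (vanish (h-deg n) _ (above-> B i)) (sym (coeff-above f (above-> B i)))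
    go n N≤n .(B ℤ.- + i) k≤j (within i) with ℕ.≤-total i n
    ... | inj₁ i≤n = trans (agree (B ℤ.- + i) i≤n -i≤) (sym (coeff-within f i))
      where
      -i≤ : ℤ.- + i ℤ.≤ B ℤ.- + i
      -i≤ = subst (ℤ._≤ B ℤ.- + i) (ℤ.+-identityˡ _) (ℤ.+-monoˡ-≤ (ℤ.- + i) (ℤ.i≤j⊔i (bound ⟦ c 0 ⟧) (+ 0)))
    ... | inj₂ n≤i = trans (sym (agree (B ℤ.- + i) n≤i -n≤)) (sym (coeff-within f i))
      where
      -n≤ : ℤ.- + n ℤ.≤ B ℤ.- + i
      -n≤ = ℤ.≤-trans (ℤ.neg-mono-≤ (ℤ.+≤+ N≤n)) (ℤ.≤-trans (-i≤∣i∣ k) k≤j)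

cf-small : ∀ c {f} → TailPositive c → IsCF c f → DegLe (f - ⟦ c 0 ⟧) (ℤ.- + 1)
cf-small c {f} pos (h , h-cf , h⟶f) = degLe λ k -1<k →
  let N , tail = h⟶f k
  in begin
    coeff (f - ⟦ c 0 ⟧) k                     ≡⟨ coeff-+ f (- ⟦ c 0 ⟧) k ⟩
    coeff f k ℚ.+ coeff (- ⟦ c 0 ⟧) k         ≡⟨ cong (ℚ._+ coeff (- ⟦ c 0 ⟧) k) (tail N ℕ.≤-refl k ℤ.≤-refl) ⟨
    coeff (h N) k ℚ.+ coeff (- ⟦ c 0 ⟧) k     ≡⟨ coeff-+ (h N) (- ⟦ c 0 ⟧) k ⟨
    coeff (h N - ⟦ c 0 ⟧) k                   ≡⟨ vanish (fraction-small c N pos (h-cf N)) k -1<k ⟩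
    0ℚ                                        ∎
  where open ≡-Reasoning

-- The degrees of λ_i and the values M(A)

module _ (g : ℤ → Poly) (pos : ∀ i → PositiveDegree (g i)) where

  lambda-exists : ∀ i → ∃[ l ] IsLambda g i l
  lambda-exists i =
    let x , x-cf = cf-exists (rightOf g i) (λ n → pos _)
        y , y-cf = cf-exists (leftOf g i) (λ n → pos _)
    in x Defs.+ y , x , y , x-cf , y-cf , λ _ → refl

  lambda-deg : ∀ {i l d} → + 1 ℤ.≤ d → Deg ⟦ g i ⟧ d → IsLambda g i l → Deg l d
  lambda-deg {i} {l} 1≤d g-deg (x , y , x-cf , y-cf , e) =
    Deg-near (subst (λ j → Deg ⟦ g j ⟧ _) (sym (ℤ.+-identityʳ i)) g-deg) 1≤d
      (DegLe-cong (begin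
        x - ⟦ gᵢ ⟧ + (y - ⟦ [] ⟧)   ≈⟨ +-cong ≋-refl (+-cong ≋-refl (neg-cong ⟦⟧-[])) ⟩
        x - ⟦ gᵢ ⟧ + (y - 0#)       ≈⟨ solve 3 (λ x c y → x :- c :+ (y :- con 0ℚ) := x :+ y :- c) ≋-refl x ⟦ gᵢ ⟧ y ⟩
        x + y - ⟦ gᵢ ⟧              ≈⟨ +-cong (≋-trans (mk≋ e) +-def) ≋-refl ⟨
        l - ⟦ gᵢ ⟧                  ∎)
        (DegLe-+ (cf-small (rightOf g i) (λ n → pos _) x-cf) (cf-small (leftOf g i) (λ n → pos _) y-cf)))
    where
    open ≋-Reasoning
    gᵢ = g (i ℤ.+ + 0)

  LambdaDegree : Pred (ℤ ±) 0ℓ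
  LambdaDegree d = ∃[ i ] ∃[ l ] (IsLambda g i l × IsDeg l d)

  lambda-degree : ∀ {d} i → IsDeg ⟦ g i ⟧ [ d ] → + 1 ℤ.≤ d → LambdaDegree [ d ]
  lambda-degree i g-deg 1≤d =
    let l , l-lambda = lambda-exists i
    in i , l , l-lambda , fromDeg l (lambda-deg 1≤d (toDeg ⟦ g i ⟧ g-deg) l-lambda)

  lambda-degree⁻¹ : ∀ {d} → LambdaDegree d → ∃[ i ] ∃[ e ] (IsDeg ⟦ g i ⟧ [ e ] × d ≡ [ e ])
  lambda-degree⁻¹ {⊥±} (i , l , l-lambda , l≈0) =
    let e , 1≤e , g-deg = pos i
    in contradiction (≋-trans (mk≋ {l} l≈0) const-def)
      (Deg⇒≉0 (lambda-deg 1≤e (toDeg ⟦ g i ⟧ g-deg) l-lambda))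
  lambda-degree⁻¹ {[ d ]} (i , l , l-lambda , l-deg) =
    let e , 1≤e , g-deg = pos i
    in i , e , g-deg , cong [_] (Deg-unique (toDeg l l-deg) (lambda-deg 1≤e (toDeg ⟦ g i ⟧ g-deg) l-lambda))

  -- As deg λ_i = deg g_i, the two families of degrees have the same upper bounds, so the supremum
  -- may be checked on the polynomials alone.
  sup-degree⇒IsM : ∀ {v} → (∀ i {d} → IsDeg ⟦ g i ⟧ [ d ] → [ d ] ≤± v) →
    (∀ u → (∀ i {d} → IsDeg ⟦ g i ⟧ [ d ] → [ d ] ≤± u) → v ≤± u) → IsM g v
  sup-degree⇒IsM {v} upper least = is-upper , λ u bound → least u λ i {d} g-deg →
    let e , 1≤e , g-deg′ = pos i
    in bound [ d ] (lambda-degree i g-deg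
      (subst (+ 1 ℤ.≤_) (Deg-unique (toDeg ⟦ g i ⟧ g-deg′) (toDeg ⟦ g i ⟧ g-deg)) 1≤e))
    where
    is-upper : ∀ d → LambdaDegree d → d ≤± v
    is-upper d d∈ =
      let i , e , g-deg , d≡e = lambda-degree⁻¹ d∈
      in subst (_≤± v) (sym d≡e) (upper i g-deg)

Admissible : Pred (ℤ ±) 0ℓ
Admissible ⊥±    = ⊥
Admissible [ n ] = + 1 ℤ.≤ n
Admissible ⊤±    = ⊤

[_]≰⊥± : ∀ d → ¬ ([ d ] ≤± ⊥±)
[ d ]≰⊥± Sup.[ () ]

≥1⇒Admissible : ∀ {d v} → + 1 ℤ.≤ d → [ d ] ≤± v → Admissible v
≥1⇒Admissible {v = ⊥±}    1≤d d≤ = [ _ ]≰⊥± d≤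
≥1⇒Admissible {v = [ n ]} 1≤d d≤n = ℤ.≤-trans 1≤d ([≤]-injective d≤n)
≥1⇒Admissible {v = ⊤±}    1≤d _   = tt

sequence⇒admissible : ∀ {v} → v ∈ SequenceValues → v ∈ Admissible
sequence⇒admissible (g , pos , upper , _) =
  let d , 1≤d , g-deg = pos (+ 0)
  in ≥1⇒Admissible 1≤d (upper [ d ] (lambda-degree g pos (+ 0) g-deg 1≤d))

power : ℕ → Poly
power zero    = 1ℚ ∷ []
power (suc n) = 0ℚ ∷ power n

power-deg : ∀ n → Deg ⟦ power n ⟧ (+ n)
power-deg zero    = Deg-cong (begin
  Defs.const 1ℚ          ≈⟨ const-def ⟩
  const 1ℚ               ≈⟨ solve 1 (λ t → con 1ℚ := con 1ℚ :+ t :* con 0ℚ) ≋-refl T ⟩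
  const 1ℚ + T * 0#      ≈⟨ +-cong ≋-refl (*-cong ≋-refl ⟦⟧-[]) ⟨
  const 1ℚ + T * ⟦ [] ⟧  ≈⟨ ⟦⟧-∷ 1ℚ [] ⟨
  ⟦ 1ℚ ∷ [] ⟧            ∎)
  (Deg-monomial (+ 0) λ ())
  where open ≋-Reasoning
power-deg (suc n) = Deg-cong (begin
  T * ⟦ power n ⟧              ≈⟨ solve 2 (λ t p → t :* p := con 0ℚ :+ t :* p) ≋-refl T ⟦ power n ⟧ ⟩
  const 0ℚ + T * ⟦ power n ⟧   ≈⟨ ⟦⟧-∷ 0ℚ (power n) ⟨
  ⟦ power (suc n) ⟧            ∎)
  (Deg-* (Deg-monomial (+ 1) λ ()) (power-deg n))
  where open ≋-Reasoning

power-IsDeg : ∀ n → IsDeg ⟦ power n ⟧ [ + n ]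
power-IsDeg n = fromDeg ⟦ power n ⟧ (power-deg n)

power-positive : ∀ n → PositiveDegree (power (suc n))
power-positive n = + suc n , ℤ.+≤+ (s≤s z≤n) , power-IsDeg (suc n)

admissible⇒sequence : ∀ {v} → v ∈ Admissible → v ∈ SequenceValues
admissible⇒sequence {⊥±} ()
admissible⇒sequence {[ + zero ]} (ℤ.+≤+ ())
admissible⇒sequence {[ + suc n ]} _ =
  (λ _ → power (suc n)) , (λ _ → power-positive n) ,
  sup-degree⇒IsM (λ _ → power (suc n)) (λ _ → power-positive n) {[ + suc n ]}
    (λ i g-deg → ≤±.[ ℤ.≤-reflexive (Deg-unique (toDeg ⟦ power (suc n) ⟧ g-deg) (power-deg (suc n))) ])
    (λ u upper → upper (+ 0) (power-IsDeg (suc n)))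
admissible⇒sequence {⊤±} _ = g , pos , sup-degree⇒IsM g pos (λ i {d} _ → [ d ] ≤⊤±) least
  where
  g : ℤ → Poly
  g i = power (suc ℤ.∣ i ∣)
  pos : ∀ i → PositiveDegree (g i)
  pos i = power-positive ℤ.∣ i ∣
  ≰ : ∀ n → ¬ ([ + suc ℤ.∣ n ∣ ] ≤± [ n ])
  ≰ (+ n)    p = ℕ.<-irrefl refl (ℤ.drop‿+≤+ ([≤]-injective p))
  ≰ -[1+ n ] p with () ← [≤]-injective p
  least : ∀ u → (∀ i {d} → IsDeg ⟦ g i ⟧ [ d ] → [ d ] ≤± u) → ⊤± ≤± u
  least ⊥±    upper = contradiction (upper (+ 0) (power-IsDeg 1)) [ _ ]≰⊥±
  -- The index `n` itself refutes the bound `n`, because g_n has degree ∣n∣ + 1.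
  least [ n ] upper = contradiction (upper n (power-IsDeg (suc ℤ.∣ n ∣))) (≰ n)
  least ⊤±    upper = ⊤± ≤⊤±

-- Quadratic forms

-- Taken on bare coefficients, since the descent changes the form at every step, and built from the
-- opaque operations so that the solver applies.
form : (A B C x y : Laurent) → Laurent
form A B C x y = A * (x * x) + B * (x * y) + C * (y * y)

discriminant : (A B C : Laurent) → Laurent
discriminant A B C = B * B - const (+ 4 ℚ./ 1) * (A * C)

module _ (Q : QuadraticForm) where
  open QuadraticForm Q

  eval-def : ∀ {x y} → eval x y ≋ form A B C x y
  eval-def = ≋-trans +-def (+-cong (≋-trans +-def (+-cong (product *-def) (product *-def))) (product *-def))
    where
    product : ∀ {f g h} → g ≋ h → f Defs.* g ≋ f * h
    product e = ≋-trans *-def (*-cong ≋-refl e)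

  disc-def : disc ≋ discriminant A B C
  disc-def = ≋-trans +-def (+-cong *-def (≋-trans neg-def (neg-cong
    (≋-trans *-def (*-cong const-def *-def)))))

form-congʸ : ∀ A B C {x x′ y y′} → x ≋ x′ → y ≋ y′ → form A B C x y ≋ form A B C x′ y′
form-congʸ A B C p q = +-cong (+-cong (*-cong ≋-refl (*-cong p p)) (*-cong ≋-refl (*-cong p q)))
  (*-cong ≋-refl (*-cong q q))

form-first : ∀ A B C → form A B C 1# 0# ≋ A
form-first = solve 3 (λ A B C →
  A :* (con 1ℚ :* con 1ℚ) :+ B :* (con 1ℚ :* con 0ℚ) :+ C :* (con 0ℚ :* con 0ℚ) := A) ≋-refl

-- θ is a root of A θ² + B θ + C.
value-near-root : ∀ {A B C I δ} X → A * I ≋ 1# → δ * δ ≋ discriminant A B C →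
  let θ = const ℚ.½ * (I * (δ - B)) in
  A * ((X - θ) * (X - θ)) + δ * (X - θ) ≋ form A B C X 1#
value-near-root {A} {B} {C} {I} {δ} X AI δδ = begin
  -- With θ′ the other root, A (θ - θ′) = δ, so A (X - θ) (X - θ′) is A (X - θ)² + δ (X - θ).
  A * ((X - θ) * (X - θ)) + δ * (X - θ)
    ≈⟨ solve 4 (λ A X θ δ → A :* ((X :- θ) :* (X :- θ)) :+ δ :* (X :- θ) :=
         A :* (X :* X) :+ (A :* θ) :* (θ :- con two :* X) :+ δ :* (X :- θ)) ≋-refl A X θ δ ⟩
  A * (X * X) + (A * θ) * (θ - const two * X) + δ * (X - θ)
    ≈⟨ +-cong (+-cong ≋-refl (*-congˡ _ Aθ)) ≋-refl ⟩
  A * (X * X) + const ℚ.½ * (δ - B) * (θ - const two * X) + δ * (X - θ)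
    ≈⟨ solve 5 (λ A B I X δ →
         let θ = con ℚ.½ :* (I :* (δ :- B)) in
         A :* (X :* X) :+ con ℚ.½ :* (δ :- B) :* (θ :- con two :* X) :+ δ :* (X :- θ) :=
         A :* (X :* X) :+ B :* (X :* con 1ℚ) :+ I :* (con ¼ :* (B :* B :- δ :* δ)) :* (con 1ℚ :* con 1ℚ))
         ≋-refl A B I X δ ⟩
  A * (X * X) + B * (X * 1#) + I * (const ¼ * (B * B - δ * δ)) * (1# * 1#)
    ≈⟨ +-cong ≋-refl (*-congˡ _ C≋) ⟨
  form A B C X 1# ∎
  where
  open ≋-Reasoning
  two ¼ : ℚ
  two = + 2 ℚ./ 1
  ¼ = + 1 ℚ./ 4
  θ = const ℚ.½ * (I * (δ - B))
  Aθ : A * θ ≋ const ℚ.½ * (δ - B)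
  Aθ = begin
    A * θ
      ≈⟨ solve 4 (λ A I δ B → A :* (con ℚ.½ :* (I :* (δ :- B))) := A :* I :* (con ℚ.½ :* (δ :- B))) ≋-refl A I δ B ⟩
    A * I * (const ℚ.½ * (δ - B))      ≈⟨ *-congˡ _ AI ⟩
    1# * (const ℚ.½ * (δ - B))         ≈⟨ *-identityˡ _ ⟩
    const ℚ.½ * (δ - B)                ∎
  -- From 4AC = B² - δ², divided by 4A.
  C≋ : C ≋ I * (const ¼ * (B * B - δ * δ))
  C≋ = begin
    C                                               ≈⟨ *-identityˡ C ⟨
    1# * C                                          ≈⟨ *-congˡ C AI ⟨
    A * I * C
      ≈⟨ solve 4 (λ A B C I → A :* I :* C :=
           I :* (con ¼ :* (B :* B :- (B :* B :- con (+ 4 ℚ./ 1) :* (A :* C))))) ≋-refl A B C I ⟩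
    I * (const ¼ * (B * B - discriminant A B C))
      ≈⟨ *-cong ≋-refl (*-cong ≋-refl (+-cong ≋-refl (neg-cong δδ))) ⟨
    I * (const ¼ * (B * B - δ * δ))                 ∎

-- The values of indefinite forms are at least 1

SmallValue : (A B C : Laurent) → ℤ → Set
SmallValue A B C e = ∃[ x ] ∃[ y ] (IsPoly x × IsPoly y × ¬ (x ≋ 0# × y ≋ 0#) × DegLe (form A B C x y) e)

-- Descent: replacing the basis by (X, 1), (1, 0), where X is the polynomial part of
-- a root θ, lowers the degree of the leading coefficient.
small-value : ∀ {e} k {A B C δ} → DegLe δ (e ℤ.+ + 1) → DegLe A (e ℤ.+ + k) →
  δ * δ ≋ discriminant A B C → SmallValue A B C e
small-value {e} zero {A} {B} {C} δ-deg A-deg δδ =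
  1# , 0# , IsPoly-const 1ℚ , IsPoly-0 , (λ (1≋0 , _) → 1≢0 1≋0) ,
  DegLe-cong (≋-sym (form-first A B C)) (subst (DegLe A) (ℤ.+-identityʳ e) A-deg)
  where
  1≢0 : ¬ (1# ≋ 0#)
  1≢0 p with () ← trans (sym (coeff-const 1ℚ 0)) (trans (un≋ p (+ 0)) (coeff-const 0ℚ 0))
-- Only a bound for deg A is known. If the coefficient at the bound is zero, the bound sinks and the
-- form stays; otherwise A has a known degree and can be inverted, so θ exists.
small-value {e} (suc k) {A} {B} {C} {δ} δ-deg A-deg δδ with coeff A (e ℤ.+ + suc k) ℚ.≟ 0ℚ
... | yes top≡0 = small-value k δ-deg (subst (DegLe A) (lem e (+ k)) (lower A-deg top≡0)) δδ
  where
  lem : ∀ e k → e ℤ.+ (+ 1 ℤ.+ k) ℤ.- + 1 ≡ e ℤ.+ k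
  lem = solve-∀
... | no top≢0 =
  let I , AI , _ = inverse (mkDeg top≢0 A-deg)
      θ = const ℚ.½ * (I * (δ - B))
      p , θ-p = poly-part θ
      X = ⟦ p ⟧
      ε-deg = DegLe-flip θ-p
      -- `A′`, `B′`, `A` are the coefficients of Q(Xx + y, x). The substitution has determinant -1,
      -- so the discriminant and its root `δ` are kept.
      A′ = form A B C X 1#
      B′ = const (+ 2 ℚ./ 1) * (A * X) + B
      -- With ε = X - θ of degree at most -1, the term A ε² has degree at most e + k - 1 and δ ε at
      -- most e; both fit under e + k.
      A′-deg = DegLe-cong (value-near-root X AI δδ) (DegLe-+
        (DegLe-mono (ε²-bound e (+ k)) (DegLe-* A-deg (DegLe-* ε-deg ε-deg)))
        (DegLe-mono (δε-bound e) (DegLe-* δ-deg ε-deg)))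
      x , y , x-poly , y-poly , nonzero , small = small-value k {A′} {B′} {A} δ-deg A′-deg
        (≋-trans δδ (solve 4 (λ A B C X →
          B :* B :- con (+ 4 ℚ./ 1) :* (A :* C) :=
          (con (+ 2 ℚ./ 1) :* (A :* X) :+ B) :* (con (+ 2 ℚ./ 1) :* (A :* X) :+ B) :-
          con (+ 4 ℚ./ 1) :* ((A :* (X :* X) :+ B :* (X :* con 1ℚ) :+ C :* (con 1ℚ :* con 1ℚ)) :* A)) ≋-refl A B C X))
  in X * x + y , x , IsPoly-+ (IsPoly-* (IsPoly-⟦⟧ p) x-poly) y-poly , x-poly ,
    (λ (Xx+y≋0 , x≋0) → nonzero (x≋0 , y≋0 X Xx+y≋0 x≋0)) ,
    DegLe-cong (solve 6 (λ A B C X x y →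
      (A :* (X :* X) :+ B :* (X :* con 1ℚ) :+ C :* (con 1ℚ :* con 1ℚ)) :* (x :* x) :+
        (con (+ 2 ℚ./ 1) :* (A :* X) :+ B) :* (x :* y) :+ A :* (y :* y) :=
      A :* ((X :* x :+ y) :* (X :* x :+ y)) :+ B :* ((X :* x :+ y) :* x) :+ C :* (x :* x)) ≋-refl A B C X x y) small
  where
  y≋0 : ∀ X {x y} → X * x + y ≋ 0# → x ≋ 0# → y ≋ 0#
  y≋0 X {x} {y} p q = begin
    y                    ≈⟨ solve 3 (λ X x y → y := X :* x :+ y :- X :* x) ≋-refl X x y ⟩
    X * x + y - X * x    ≈⟨ +-cong p (neg-cong (*-cong ≋-refl q)) ⟩
    0# - X * 0#          ≈⟨ solve 1 (λ X → con 0ℚ :- X :* con 0ℚ := con 0ℚ) ≋-refl X ⟩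
    0#                   ∎
    where open ≋-Reasoning
  ε²-bound : ∀ e k → e ℤ.+ (+ 1 ℤ.+ k) ℤ.+ (ℤ.- + 1 ℤ.+ ℤ.- + 1) ℤ.≤ e ℤ.+ k
  ε²-bound e k = subst (ℤ._≤ e ℤ.+ k) (lem e k) (ℤ.i-j≤i (e ℤ.+ k) (+ 1))
    where
    lem : ∀ e k → e ℤ.+ k ℤ.- + 1 ≡ e ℤ.+ (+ 1 ℤ.+ k) ℤ.+ (ℤ.- + 1 ℤ.+ ℤ.- + 1)
    lem = solve-∀
  δε-bound : ∀ e → e ℤ.+ + 1 ℤ.+ ℤ.- + 1 ℤ.≤ e ℤ.+ + k
  δε-bound e = subst (ℤ._≤ e ℤ.+ + k) (lem e) (ℤ.i≤i+j e (+ k))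
    where
    lem : ∀ e → e ≡ e ℤ.+ + 1 ℤ.+ ℤ.- + 1
    lem = solve-∀

-- Supplies the natural number on which `sqrt-DegLe` and `small-value` recurse.
DegLe-above : ∀ f d → ∃[ k ] DegLe f (d ℤ.+ + k)
DegLe-above f d = go (bound f) (DegLe-bound f) (position d (bound f))
  where
  go : ∀ b → DegLe f b → Position d b → ∃[ k ] DegLe f (d ℤ.+ + k)
  go _ p (above j)  = suc j , p
  go _ p (within j) = 0 , DegLe-mono (ℤ.≤-trans (within-≤ d j) (ℤ.i≤i+j d (+ 0))) p

-- At a bound a > m of `f`, the square of the coefficient at a is the coefficient of f² at 2a > 2m,
-- hence zero. So the bound sinks step by step to m.
sqrt-DegLe : ∀ {f m} → DegLe (f * f) (m ℤ.+ m) → DegLe f m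
sqrt-DegLe {f} {m} sq = let k , p = DegLe-above f m in go k p
  where
  go : ∀ k → DegLe f (m ℤ.+ + k) → DegLe f m
  go zero    p = subst (DegLe f) (ℤ.+-identityʳ m) p
  go (suc k) p = go k (subst (DegLe f) (lem m (+ k)) (lower p top≡0))
    where
    lem : ∀ e k → e ℤ.+ (+ 1 ℤ.+ k) ℤ.- + 1 ≡ e ℤ.+ k
    lem = solve-∀
    a = m ℤ.+ + suc k
    square≡0 : coeff f a ℚ.* coeff f a ≡ 0ℚ
    square≡0 = trans (sym (coeff-*-top p p)) (vanish sq _ (ℤ.+-mono-< (above-> m k) (above-> m k)))
    top≡0 : coeff f a ≡ 0ℚ
    top≡0 with coeff f a ℚ.≟ 0ℚ
    ... | yes z = z
    ... | no nz = *-nonzero nz square≡0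

-- Whether a series vanishes is undecidable, so "zero or of some degree" holds only up to ¬¬.
degree-cases : ∀ {f e} → DegLe f e → ¬ (f ≋ 0#) → (∀ d → d ℤ.≤ e → ¬ Deg f d) → ⊥
degree-cases {f} {e} f-deg f≉0 no-deg = f≉0 (≋0 e go)
  where
  lem : ∀ e k → e ℤ.- k ℤ.- + 1 ≡ e ℤ.- (+ 1 ℤ.+ k)
  lem = solve-∀
  go : ∀ n → DegLe f (e ℤ.- + n)
  go zero    = subst (DegLe f) (sym (ℤ.+-identityʳ e)) f-deg
  go (suc n) with coeff f (e ℤ.- + n) ℚ.≟ 0ℚ
  ... | yes z = subst (DegLe f) (lem e (+ n)) (lower (go n) z)
  ... | no nz = contradiction (mkDeg nz (go n)) (no-deg _ (within-≤ e n))

-- Since `1 ≤ v` is decidable, a contradiction from v ≤ 0 is enough, and this admits the doubly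
-- negated `degree-cases`. If v ≤ 0, then deg D ≤ 2m, so deg δ ≤ m, and the descent with e = m - 1
-- finds a nonzero vector whose value lies below the minimum m.
markov⇒admissible : ∀ {v} → v ∈ MarkovSpectrum → v ∈ Admissible
markov⇒admissible {⊤±} _ = tt
markov⇒admissible {[ v ]} (Q , (_ , δ , δδ) , d , m , D-deg , (lower-bound , _) , 2v) with + 1 ℤ.≤? v
... | yes 1≤v = 1≤v
... | no 1≰v  = ⊥-elim contra
  where
  open QuadraticForm Q
  δδ≋D : δ * δ ≋ disc
  δδ≋D = ≋-trans (≋-sym *-def) (mk≋ δδ)
  v≤0 : v ℤ.≤ + 0
  v≤0 = ℤ.i<j⇒i≤pred[j] (ℤ.≰⇒> 1≰v)
  d≤2m : d ℤ.≤ m ℤ.+ m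
  d≤2m = subst (d ℤ.≤_) (lem m) (ℤ.i-j≤0⇒i≤j (subst (ℤ._≤ + 0) 2v (ℤ.*-monoˡ-≤-nonNeg (+ 2) v≤0)))
    where lem : ∀ m → + 2 ℤ.* m ≡ m ℤ.+ m
          lem = solve-∀
  e = m ℤ.- + 1
  e+1 : e ℤ.+ + 1 ≡ m
  e+1 = lem m
    where lem : ∀ m → m ℤ.- + 1 ℤ.+ + 1 ≡ m
          lem = solve-∀
  δ-deg : DegLe δ (e ℤ.+ + 1)
  δ-deg = subst (DegLe δ) (sym e+1) (sqrt-DegLe (DegLe-cong (≋-sym δδ≋D)
    (DegLe-mono d≤2m (Deg⇒DegLe (toDeg disc D-deg)))))
  contra : ⊥
  contra =
    let k , A-deg = DegLe-above A e
        x , y , (p , p≋x) , (q , q≋y) , nonzero , small = small-value k δ-deg A-deg (≋-trans δδ≋D (disc-def Q))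
        nonzero′ : ¬ (⟦ p ⟧ ≈ Defs.0# × ⟦ q ⟧ ≈ Defs.0#)
        nonzero′ = λ (p≈0 , q≈0) → nonzero
          (≋-trans (≋-sym p≋x) (≋-trans (mk≋ p≈0) const-def) , ≋-trans (≋-sym q≋y) (≋-trans (mk≋ q≈0) const-def))
        small′ : DegLe (eval ⟦ p ⟧ ⟦ q ⟧) e
        small′ = DegLe-cong (≋-sym (≋-trans (eval-def Q) (form-congʸ A B C p≋x q≋y))) small
    in degree-cases small′
      (λ z → [ m ]≰⊥± (lower-bound ⊥± (p , q , nonzero′ , un≋ (≋-trans z (≋-sym const-def)))))
      (λ d d≤e d-deg → ℤ.<⇒≱ m-1<m (ℤ.≤-trans
        ([≤]-injective (lower-bound [ d ] (p , q , nonzero′ , fromDeg (eval ⟦ p ⟧ ⟦ q ⟧) d-deg))) d≤e))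
    where
    m-1<m : e ℤ.< m
    m-1<m = subst (e ℤ.<_) e+1 (above-> e 0)

-- Forms attaining the values

-- The order of ℚ enters here: the left side is at least 0 and the right side at most 0.
sum-of-squares : ∀ a b → a ℚ.* a ≡ ℚ.- (b ℚ.* b) → a ≡ 0ℚ × b ≡ 0ℚ
sum-of-squares a b a²≡-b² = square≡0 a a² , square≡0 b b²
  where
  square≥0 : ∀ a → 0ℚ ℚ.≤ a ℚ.* a
  square≥0 a with ℚ.≤-total 0ℚ a
  ... | inj₁ 0≤a = subst (ℚ._≤ a ℚ.* a) (ℚ.*-zeroʳ a) (ℚ.*-monoˡ-≤-nonNeg a {{ℚ.nonNegative 0≤a}} 0≤a)
  ... | inj₂ a≤0 = subst (ℚ._≤ a ℚ.* a) (ℚ.*-zeroʳ a) (ℚ.*-monoˡ-≤-nonPos a {{ℚ.nonPositive a≤0}} a≤0)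
  square≡0 : ∀ a → a ℚ.* a ≡ 0ℚ → a ≡ 0ℚ
  square≡0 a z with a ℚ.≟ 0ℚ
  ... | yes a≡0 = a≡0
  ... | no a≢0  = *-nonzero a≢0 z
  a² : a ℚ.* a ≡ 0ℚ
  a² = ℚ.≤-antisym (subst (ℚ._≤ 0ℚ) (sym a²≡-b²) (ℚ.neg-antimono-≤ (square≥0 b))) (square≥0 a)
  b² : b ℚ.* b ≡ 0ℚ
  b² = ℚ.neg-injective (trans (sym a²≡-b²) a²)

uncons : ∀ {f} → IsPoly f → ∃[ a ] ∃[ g ] (IsPoly g × f ≋ const a + T * g)
uncons ([]    , e) = 0ℚ , 0# , IsPoly-0 , ≋-trans (≋-sym e) (≋-trans ⟦⟧-[]
  (solve 1 (λ t → con 0ℚ := con 0ℚ :+ t :* con 0ℚ) ≋-refl T))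
uncons (a ∷ p , e) = a , ⟦ p ⟧ , IsPoly-⟦⟧ p , ≋-trans (≋-sym e) (⟦⟧-∷ a p)

constant-term : ∀ {g} a → IsPoly g → coeff (const a + T * g) (+ 0) ≡ a
constant-term {g} a g-poly = begin
  coeff (const a + T * g) (+ 0)                     ≡⟨ coeff-+ (const a) (T * g) (+ 0) ⟩
  coeff (const a) (+ 0) ℚ.+ coeff (T * g) (+ 0)     ≡⟨ cong₂ ℚ._+_ (coeff-const a 0) (coeff-T* g (+ 0)) ⟩
  a ℚ.+ coeff g (ℤ.- + 1)                           ≡⟨ cong (a ℚ.+_) (IsPoly-vanish g-poly _ ℤ.-<+) ⟩
  a ℚ.+ 0ℚ                                          ≡⟨ ℚ.+-identityʳ a ⟩
  a                                                 ∎
  where open ≡-Reasoning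

Deg-T : Deg T (+ 1)
Deg-T = Deg-monomial (+ 1) λ ()

*-cancelˡ : ∀ {f g h d} → Deg f d → f * g ≋ f * h → g ≋ h
*-cancelˡ {f} {g} {h} f-deg e =
  let I , fI , _ = inverse f-deg
  in begin
    g              ≈⟨ *-identityˡ g ⟨
    1# * g         ≈⟨ *-congˡ g fI ⟨
    f * I * g      ≈⟨ solve 3 (λ f g I → f :* I :* g := I :* (f :* g)) ≋-refl f g I ⟩
    I * (f * g)    ≈⟨ *-cong ≋-refl e ⟩
    I * (f * h)    ≈⟨ solve 3 (λ f h I → I :* (f :* h) := f :* I :* h) ≋-refl f h I ⟩
    f * I * h      ≈⟨ *-congˡ h fI ⟩
    1# * h         ≈⟨ *-identityˡ h ⟩
    h              ∎
  where open ≋-Reasoning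

-- T² - 1: not a square in ℚ(T), a square in ℚ((1/T))

Δ : Laurent
Δ = T * T - 1#

IsPoly-neg : ∀ {f} → IsPoly f → IsPoly (- f)
IsPoly-neg {f} p = IsPoly-cong (solve 1 (λ f → con (ℚ.- 1ℚ) :* f := :- f) ≋-refl f) (IsPoly-const* (ℚ.- 1ℚ) p)

IsPoly-Δ : IsPoly Δ
IsPoly-Δ = IsPoly-+ (IsPoly-T* IsPoly-T) (IsPoly-neg (IsPoly-const 1ℚ))

-- At T = 0 the equation reads a² = - b², so a = b = 0 and T divides both sides.
Δ-nonsquare-step : ∀ {f g} → IsPoly f → IsPoly g → f * f ≋ Δ * (g * g) →
  ∃[ f′ ] ∃[ g′ ] (IsPoly f′ × IsPoly g′ × f ≋ T * f′ × g ≋ T * g′ × f′ * f′ ≋ Δ * (g′ * g′))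
Δ-nonsquare-step {f} {g} f-poly g-poly eq =
  let a , f′ , f′-poly , f≋ = uncons f-poly
      b , g′ , g′-poly , g≋ = uncons g-poly
      a≡0 , b≡0 = sum-of-squares a b (constants f′-poly g′-poly f≋ g≋)
      f≋Tf′ = divisible a≡0 f≋
      g≋Tg′ = divisible b≡0 g≋
  in f′ , g′ , f′-poly , g′-poly , f≋Tf′ , g≋Tg′ , *-cancelˡ (Deg-* Deg-T Deg-T) (begin
    T * T * (f′ * f′)            ≈⟨ solve 2 (λ t f → t :* t :* (f :* f) := t :* f :* (t :* f)) ≋-refl T f′ ⟩
    T * f′ * (T * f′)            ≈⟨ *-cong f≋Tf′ f≋Tf′ ⟨
    f * f                        ≈⟨ eq ⟩
    Δ * (g * g)                  ≈⟨ *-cong ≋-refl (*-cong g≋Tg′ g≋Tg′) ⟩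
    Δ * (T * g′ * (T * g′))      ≈⟨ solve 3 (λ t d g → d :* (t :* g :* (t :* g)) := t :* t :* (d :* (g :* g))) ≋-refl T Δ g′ ⟩
    T * T * (Δ * (g′ * g′))      ∎)
  where
  open ≋-Reasoning
  divisible : ∀ {a f f′} → a ≡ 0ℚ → f ≋ const a + T * f′ → f ≋ T * f′
  divisible {f′ = f′} refl e = ≋-trans e (solve 2 (λ t f → con 0ℚ :+ t :* f := t :* f) ≋-refl T f′)
  module _ {a b f′ g′} (f′-poly : IsPoly f′) (g′-poly : IsPoly g′)
    (f≋ : f ≋ const a + T * f′) (g≋ : g ≋ const b + T * g′) where
    two : ℚ
    two = + 2 ℚ./ 1
    f² : f * f ≋ const (a ℚ.* a) + T * (const two * (const a * f′) + T * (f′ * f′))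
    f² = begin
      f * f                                           ≈⟨ *-cong f≋ f≋ ⟩
      (const a + T * f′) * (const a + T * f′)
        ≈⟨ solve 3 (λ a t f → (a :+ t :* f) :* (a :+ t :* f) := a :* a :+ t :* (con two :* (a :* f) :+ t :* (f :* f)))
             ≋-refl (const a) T f′ ⟩
      const a * const a + T * (const two * (const a * f′) + T * (f′ * f′))
        ≈⟨ +-cong (const-* a a) ≋-refl ⟨
      const (a ℚ.* a) + T * (const two * (const a * f′) + T * (f′ * f′))  ∎
    Δg² : Δ * (g * g) ≋ const (ℚ.- (b ℚ.* b)) +
      T * (T * (g * g) - (const two * (const b * g′) + T * (g′ * g′)))
    Δg² = begin
      (T * T - 1#) * (g * g)         ≈⟨ solve 2 (λ t g → (t :* t :- con 1ℚ) :* (g :* g) := t :* t :* (g :* g) :- g :* g) ≋-refl T g ⟩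
      T * T * (g * g) - g * g        ≈⟨ +-cong ≋-refl (neg-cong (*-cong g≋ g≋)) ⟩
      T * T * (g * g) - (const b + T * g′) * (const b + T * g′)
        ≈⟨ solve 4 (λ b t g h → t :* t :* (h :* h) :- (b :+ t :* g) :* (b :+ t :* g) :=
             :- (b :* b) :+ t :* (t :* (h :* h) :- (con two :* (b :* g) :+ t :* (g :* g))))
             ≋-refl (const b) T g′ g ⟩
      - (const b * const b) + T * (T * (g * g) - (const two * (const b * g′) + T * (g′ * g′)))
        ≈⟨ +-cong (≋-trans (const-neg (b ℚ.* b)) (neg-cong (const-* b b))) ≋-refl ⟨
      const (ℚ.- (b ℚ.* b)) + T * (T * (g * g) - (const two * (const b * g′) + T * (g′ * g′)))  ∎
    cross-poly : ∀ {f} a → IsPoly f → IsPoly (const two * (const a * f) + T * (f * f))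
    cross-poly a p = IsPoly-+ (IsPoly-const* two (IsPoly-const* a p)) (IsPoly-T* (IsPoly-* p p))
    constants : a ℚ.* a ≡ ℚ.- (b ℚ.* b)
    constants = trans (sym (constant-term (a ℚ.* a) (cross-poly a f′-poly)))
      (trans (un≋ (≋-trans (≋-sym f²) (≋-trans eq Δg²)) (+ 0))
        (constant-term (ℚ.- (b ℚ.* b))
          (IsPoly-+ (IsPoly-T* (IsPoly-* g-poly g-poly)) (IsPoly-neg (cross-poly b g′-poly)))))

-- Repeated division by T offers no decreasing measure when the polynomials may be zero, so the
-- recursion is on the exponent instead: after k + 1 divisions T^(k+1) divides both, and their
-- coefficients at T^k vanish.
Δ-nonsquare : ∀ {f g} → IsPoly f → IsPoly g → f * f ≋ Δ * (g * g) → f ≋ 0# × g ≋ 0#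
Δ-nonsquare f-poly g-poly eq =
  zero-poly f-poly (λ k → proj₁ (go k f-poly g-poly eq)) , zero-poly g-poly (λ k → proj₂ (go k f-poly g-poly eq))
  where
  zero-poly : ∀ {f} → IsPoly f → (∀ k → coeff f (+ k) ≡ 0ℚ) → f ≋ 0#
  zero-poly {f} f-poly z = mk≋ λ k → trans (vanishes k) (sym (coeff-0 k))
    where
    vanishes : ∀ k → coeff f k ≡ 0ℚ
    vanishes (+ k)    = z k
    vanishes -[1+ k ] = IsPoly-vanish f-poly _ ℤ.-<+
  shift : ∀ {f f′} → f ≋ T * f′ → ∀ k → coeff f k ≡ coeff f′ (k ℤ.- + 1)
  shift {f′ = f′} e k = trans (un≋ e k) (coeff-T* f′ k)
  go : ∀ k {f g} → IsPoly f → IsPoly g → f * f ≋ Δ * (g * g) → coeff f (+ k) ≡ 0ℚ × coeff g (+ k) ≡ 0ℚ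
  go zero    f-poly g-poly eq =
    let _ , _ , f′-poly , g′-poly , f≋ , g≋ , _ = Δ-nonsquare-step f-poly g-poly eq
    in trans (shift f≋ (+ 0)) (IsPoly-vanish f′-poly _ ℤ.-<+) , trans (shift g≋ (+ 0)) (IsPoly-vanish g′-poly _ ℤ.-<+)
  go (suc k) f-poly g-poly eq =
    let _ , _ , f′-poly , g′-poly , f≋ , g≋ , eq′ = Δ-nonsquare-step f-poly g-poly eq
        f′≡0 , g′≡0 = go k f′-poly g′-poly eq′
    in trans (shift f≋ (+ suc k)) f′≡0 , trans (shift g≋ (+ suc k)) g′≡0

sqrtΔ : ∃[ r ] (Deg r (+ 1) × r * r ≋ Δ)
sqrtΔ = r , mkDeg (λ ()) (DegLe-bound r) , ≋-trans (*-≋ (≋-refl {r}) (≋-refl {r})) (≋-trans (≋-digits refl square) Δ-digits)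
  where
  -- The square root of 1 - T⁻² is 1 + T⁻¹ w, where w = - T⁻¹ (1 + w²) / 2.
  F : Seq → Seq
  F w zero    = 0ℚ
  F w (suc n) = ℚ.- ℚ.½ ℚ.* (leading 1ℚ n ℚ.+ conv w w n)
  F-causal : ∀ v w n → (∀ i → i ℕ.< n → v i ≡ w i) → F v n ≡ F w n
  F-causal v w zero    e = refl
  F-causal v w (suc n) e = cong (λ x → ℚ.- ℚ.½ ℚ.* (leading 1ℚ n ℚ.+ x))
    (conv-local {v} {w} {v} {w} n (λ i i≤n → e i (s≤s i≤n)) (λ i i≤n → e i (s≤s i≤n)))
  open Recursion F F-causal renaming (fix to w; fix-eq to w-eq)
  a : Seq
  a zero    = 1ℚ
  a (suc n) = w n
  r : Laurent
  r = mkLaurent (+ 1) a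
  -- The digits of T² - 1, counted down from T².
  d : Seq
  d zero                = 1ℚ
  d (suc zero)          = 0ℚ
  d (suc (suc zero))    = ℚ.- 1ℚ
  d (suc (suc (suc n))) = 0ℚ
  square : ∀ n → conv a a n ≡ d n
  square zero          = refl
  square (suc zero)    = refl
  -- The first and last terms each contribute `w (suc n)`, and the recursion for `w` makes their sum
  -- cancel `conv w w n`, leaving only the -1 of T² - 1.
  square (suc (suc n)) = begin
    1ℚ ℚ.* w (suc n) ℚ.+ conv w a (suc n)
      ≡⟨ cong (1ℚ ℚ.* w (suc n) ℚ.+_) (conv-sucʳ w a n) ⟩
    1ℚ ℚ.* w (suc n) ℚ.+ (conv w w n ℚ.+ w (suc n) ℚ.* 1ℚ)
      ≡⟨ cong (λ x → 1ℚ ℚ.* x ℚ.+ (conv w w n ℚ.+ x ℚ.* 1ℚ)) (w-eq (suc n)) ⟩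
    1ℚ ℚ.* (ℚ.- ℚ.½ ℚ.* (leading 1ℚ n ℚ.+ conv w w n)) ℚ.+
      (conv w w n ℚ.+ ℚ.- ℚ.½ ℚ.* (leading 1ℚ n ℚ.+ conv w w n) ℚ.* 1ℚ)
      ≡⟨ S.solve 2 (λ l c →
           S.con 1ℚ S.:* (S.con (ℚ.- ℚ.½) S.:* (l S.:+ c)) S.:+ (c S.:+ S.con (ℚ.- ℚ.½) S.:* (l S.:+ c) S.:* S.con 1ℚ) S.:= S.:- l)
           refl (leading 1ℚ n) (conv w w n) ⟩
    ℚ.- leading 1ℚ n   ≡⟨ last n ⟩
    d (suc (suc n))    ∎
    where
    open ≡-Reasoning
    module S = +-*-Solver
    last : ∀ n → ℚ.- leading 1ℚ n ≡ d (suc (suc n))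
    last zero    = refl
    last (suc n) = refl
  Δ-digits : mkLaurent (+ 2) d ≋ Δ
  Δ-digits = ≋-from (+ 2) (DegLe-bound (mkLaurent (+ 2) d))
    (DegLe-+ (DegLe-* (Deg⇒DegLe Deg-T) (Deg⇒DegLe Deg-T)) (DegLe-neg (DegLe-mono (ℤ.+≤+ z≤n) 1#-deg))) λ j →
    trans (at-within d (+ 2) j) (sym (trans (coeff-+ (T * T) (- 1#) (+ 2 ℤ.- + j))
      (trans (cong₂ ℚ._+_ (coeff-T* T (+ 2 ℤ.- + j)) (coeff-neg 1# (+ 2 ℤ.- + j))) (digit-of j))))
    where
    1#-deg : DegLe 1# (+ 0)
    1#-deg = DegLe-cong const-def (DegLe-bound Defs.1#)
    digit-of : ∀ j → coeff T (+ 2 ℤ.- + j ℤ.- + 1) ℚ.- coeff 1# (+ 2 ℤ.- + j) ≡ d j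
    digit-of zero                = cong (λ x → 1ℚ ℚ.- x) (coeff-const 1ℚ 2)
    digit-of (suc zero)          = cong (λ x → 0ℚ ℚ.- x) (coeff-const 1ℚ 1)
    digit-of (suc (suc zero))    = cong (λ x → 0ℚ ℚ.- x) (coeff-const 1ℚ 0)
    digit-of (suc (suc (suc n))) = cong (λ x → 0ℚ ℚ.- x) (coeff-const-neg 1ℚ n)

-- Forms scaled by a square root of T² - 1

module _ {r : Laurent} (r-deg : Deg r (+ 1)) (rr : r * r ≋ Δ) where

  irrational : ¬ IsRational r
  irrational (p , q , q≉0 , e) = q≉0 (un≋ (≋-trans (proj₂ (Δ-nonsquare (IsPoly-⟦⟧ p) (IsPoly-⟦⟧ q) (begin
    ⟦ p ⟧ * ⟦ p ⟧                  ≈⟨ *-cong qr≋p qr≋p ⟨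
    ⟦ q ⟧ * r * (⟦ q ⟧ * r)        ≈⟨ solve 2 (λ q r → q :* r :* (q :* r) := r :* r :* (q :* q)) ≋-refl ⟦ q ⟧ r ⟩
    r * r * (⟦ q ⟧ * ⟦ q ⟧)        ≈⟨ *-congˡ _ rr ⟩
    Δ * (⟦ q ⟧ * ⟦ q ⟧)            ∎))) (≋-sym const-def)))
    where
    open ≋-Reasoning
    qr≋p : ⟦ q ⟧ * r ≋ ⟦ p ⟧
    qr≋p = ≋-trans (≋-sym *-def) (mk≋ e)

  ⟦1⟧ : ⟦ 1ℚ ∷ [] ⟧ ≋ 1#
  ⟦1⟧ = begin
    ⟦ 1ℚ ∷ [] ⟧              ≈⟨ ⟦⟧-∷ 1ℚ [] ⟩
    const 1ℚ + T * ⟦ [] ⟧    ≈⟨ +-cong ≋-refl (*-cong ≋-refl ⟦⟧-[]) ⟩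
    const 1ℚ + T * 0#        ≈⟨ solve 1 (λ t → con 1ℚ :+ t :* con 0ℚ := con 1ℚ) ≋-refl T ⟩
    1#                       ∎
    where open ≋-Reasoning

  ⟦1⟧≉0 : ¬ (⟦ 1ℚ ∷ [] ⟧ ≈ Defs.0# × ⟦ [] ⟧ ≈ Defs.0#)
  ⟦1⟧≉0 (z , _) = Deg⇒≉0 (Deg-cong const-def (Deg-monomial (+ 0) λ ())) (begin
    1#             ≈⟨ ⟦1⟧ ⟨
    ⟦ 1ℚ ∷ [] ⟧    ≈⟨ mk≋ z ⟩
    Defs.0#        ≈⟨ const-def ⟩
    0#             ∎)
    where open ≋-Reasoning

  productForm : QuadraticForm
  productForm = record
    { A = 0# ; B = r ; C = 0# ; notAllRational = λ (_ , B-rational , _) → irrational B-rational }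

  productForm-indefinite : Indefinite productForm
  productForm-indefinite =
    (λ z → Deg⇒≉0 (Deg-* r-deg r-deg) (≋-trans (≋-sym disc≋) (≋-trans (mk≋ z) const-def))) ,
    r , un≋ (≋-trans *-def (≋-sym disc≋))
    where
    disc≋ : QuadraticForm.disc productForm ≋ r * r
    disc≋ = ≋-trans (disc-def productForm)
      (solve 1 (λ r → r :* r :- con (+ 4 ℚ./ 1) :* (con 0ℚ :* con 0ℚ) := r :* r) ≋-refl r)

  -- The form vanishes at (1, 0), so -∞ is itself one of the degrees.
  productForm-value : IsValue productForm ⊤±
  productForm-value = (λ d _ → ≤±.⊥±≤ d) , λ u bound → bound ⊥±
    (1ℚ ∷ [] , [] , ⟦1⟧≉0 , un≋ (begin
      QuadraticForm.eval productForm ⟦ 1ℚ ∷ [] ⟧ ⟦ [] ⟧   ≈⟨ eval-def productForm ⟩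
      form 0# r 0# ⟦ 1ℚ ∷ [] ⟧ ⟦ [] ⟧                     ≈⟨ form-congʸ 0# r 0# ⟦1⟧ ⟦⟧-[] ⟩
      form 0# r 0# 1# 0#                                  ≈⟨ form-first 0# r 0# ⟩
      0#                                                  ≈⟨ const-def ⟨
      Defs.0#                                             ∎))
    where open ≋-Reasoning

  module _ (k : ℕ) where

    t : Laurent
    t = ⟦ power k ⟧

    -- With t = T^k this is r (X + r t Y) (X - r t Y): r times the norm of X + r t Y from ℚ(T)(r) to
    -- ℚ(T), which is zero only for X = Y = 0.
    normForm : QuadraticForm
    normForm = record
      { A = r ; B = 0# ; C = - (r * (Δ * (t * t)))
      ; notAllRational = λ (A-rational , _) → irrational A-rational }

    open QuadraticForm normForm using (disc; eval)

    -- As r² = Δ, the discriminant 4 r² Δ t² is 4 Δ² t². Its root has degree k + 2, and the minimum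
    -- 1 = deg r then gives the value k + 1.
    δ : Laurent
    δ = const (+ 2 ℚ./ 1) * (t * Δ)

    Δ-deg : Deg Δ (+ 2)
    Δ-deg = Deg-cong rr (Deg-* r-deg r-deg)

    δ-deg : Deg δ (+ 0 ℤ.+ (+ k ℤ.+ + 2))
    δ-deg = Deg-* (Deg-cong const-def (Deg-monomial (+ 0) λ ())) (Deg-* (power-deg k) Δ-deg)

    disc≋ : disc ≋ δ * δ
    disc≋ = begin
      disc                                          ≈⟨ disc-def normForm ⟩
      discriminant r 0# (- (r * (Δ * (t * t))))
        ≈⟨ solve 3 (λ r d t → con 0ℚ :* con 0ℚ :- con (+ 4 ℚ./ 1) :* (r :* (:- (r :* (d :* (t :* t))))) :=
             con (+ 4 ℚ./ 1) :* (r :* r :* (d :* (t :* t)))) ≋-refl r Δ t ⟩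
      const (+ 4 ℚ./ 1) * (r * r * (Δ * (t * t)))   ≈⟨ *-cong ≋-refl (*-congˡ _ rr) ⟩
      const (+ 4 ℚ./ 1) * (Δ * (Δ * (t * t)))
        ≈⟨ solve 2 (λ d t → con (+ 4 ℚ./ 1) :* (d :* (d :* (t :* t))) :=
             con (+ 2 ℚ./ 1) :* (t :* d) :* (con (+ 2 ℚ./ 1) :* (t :* d))) ≋-refl Δ t ⟩
      δ * δ                                         ∎
      where open ≋-Reasoning

    normForm-indefinite : Indefinite normForm
    normForm-indefinite =
      (λ z → Deg⇒≉0 (Deg-* δ-deg δ-deg) (≋-trans (≋-sym disc≋) (≋-trans (mk≋ z) const-def))) ,
      δ , un≋ (≋-trans *-def (≋-sym disc≋))

    norm : Poly → Poly → Laurent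
    norm X Y = ⟦ X ⟧ * ⟦ X ⟧ - Δ * (t * ⟦ Y ⟧ * (t * ⟦ Y ⟧))

    norm-poly : ∀ X Y → IsPoly (norm X Y)
    norm-poly X Y = IsPoly-+ (IsPoly-* (IsPoly-⟦⟧ X) (IsPoly-⟦⟧ X))
      (IsPoly-neg (IsPoly-* IsPoly-Δ (IsPoly-* tY tY)))
      where tY = IsPoly-* (IsPoly-⟦⟧ (power k)) (IsPoly-⟦⟧ Y)

    eval-norm : ∀ X Y → eval ⟦ X ⟧ ⟦ Y ⟧ ≋ r * norm X Y
    eval-norm X Y = ≋-trans (eval-def normForm)
      (solve 5 (λ r d t x y →
        r :* (x :* x) :+ con 0ℚ :* (x :* y) :+ (:- (r :* (d :* (t :* t)))) :* (y :* y) :=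
        r :* (x :* x :- d :* (t :* y :* (t :* y)))) ≋-refl r Δ t ⟦ X ⟧ ⟦ Y ⟧)

    norm≉0 : ∀ X Y → ¬ (⟦ X ⟧ ≈ Defs.0# × ⟦ Y ⟧ ≈ Defs.0#) → ¬ (norm X Y ≋ 0#)
    norm≉0 X Y nonzero z =
      let X≋0 , tY≋0 = Δ-nonsquare (IsPoly-⟦⟧ X) (IsPoly-* (IsPoly-⟦⟧ (power k)) (IsPoly-⟦⟧ Y)) X²
          Y≋0 = *-cancelˡ (power-deg k) (≋-trans tY≋0 (≋-sym (*-zeroʳ t)))
      in nonzero (un≋ (≋-trans X≋0 (≋-sym const-def)) , un≋ (≋-trans Y≋0 (≋-sym const-def)))
      where
      open ≋-Reasoning
      Z = Δ * (t * ⟦ Y ⟧ * (t * ⟦ Y ⟧))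
      X² : ⟦ X ⟧ * ⟦ X ⟧ ≋ Z
      X² = begin
        ⟦ X ⟧ * ⟦ X ⟧          ≈⟨ solve 2 (λ x z → x :* x := x :* x :- z :+ z) ≋-refl ⟦ X ⟧ Z ⟩
        norm X Y + Z           ≈⟨ +-cong z ≋-refl ⟩
        0# + Z                 ≈⟨ +-identityˡ Z ⟩
        Z                      ∎

    -- The norm is a nonzero polynomial, so its degree is at least 0.
    value-deg : ∀ {f d} → IsPoly f → Deg (r * f) d → + 1 ℤ.≤ d
    value-deg {f} {d} f-poly rf-deg with + 1 ℤ.≤? d
    ... | yes 1≤d = 1≤d
    ... | no 1≰d  = ⊥-elim (Deg⇒≉0 rf-deg (≋-trans (*-cong ≋-refl f≋0) (*-zeroʳ r)))
      where
      f-small : DegLe f (ℤ.- + 1)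
      f-small =
        let I , rI , I-deg = inverse r-deg
        in DegLe-mono (ℤ.+-monoʳ-≤ (ℤ.- + 1) (ℤ.i<j⇒i≤pred[j] (ℤ.≰⇒> 1≰d))) (DegLe-cong (begin
          I * (r * f)    ≈⟨ solve 3 (λ i r f → i :* (r :* f) := r :* i :* f) ≋-refl I r f ⟩
          r * I * f      ≈⟨ *-congˡ f rI ⟩
          1# * f         ≈⟨ *-identityˡ f ⟩
          f              ∎) (DegLe-* I-deg (Deg⇒DegLe rf-deg)))
        where open ≋-Reasoning
      f≋0 : f ≋ 0#
      f≋0 = mk≋ λ k → trans (vanishes k) (sym (coeff-0 k))
        where
        vanishes : ∀ k → coeff f k ≡ 0ℚ
        vanishes (+ k)    = vanish f-small (+ k) ℤ.-<+
        vanishes -[1+ k ] = IsPoly-vanish f-poly _ ℤ.-<+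

    normForm-min : QuadraticForm.IsMin normForm [ + 1 ]
    normForm-min = is-lower , λ u bound → bound [ + 1 ] (1ℚ ∷ [] , [] , ⟦1⟧≉0 , fromDeg (eval ⟦ 1ℚ ∷ [] ⟧ ⟦ [] ⟧) at-1)
      where
      at-1 : Deg (eval ⟦ 1ℚ ∷ [] ⟧ ⟦ [] ⟧) (+ 1)
      at-1 = Deg-cong (≋-sym (begin
        eval ⟦ 1ℚ ∷ [] ⟧ ⟦ [] ⟧          ≈⟨ eval-def normForm ⟩
        form r 0# C ⟦ 1ℚ ∷ [] ⟧ ⟦ [] ⟧   ≈⟨ form-congʸ r 0# C ⟦1⟧ ⟦⟧-[] ⟩
        form r 0# C 1# 0#                ≈⟨ form-first r 0# C ⟩
        r                                ∎)) r-deg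
        where
        open ≋-Reasoning
        C = - (r * (Δ * (t * t)))
      is-lower : ∀ d →
        (∃[ X ] ∃[ Y ] (¬ (⟦ X ⟧ ≈ Defs.0# × ⟦ Y ⟧ ≈ Defs.0#) × IsDeg (eval ⟦ X ⟧ ⟦ Y ⟧) d)) → [ + 1 ] ≤± d
      is-lower ⊥± (X , Y , nonzero , z) = contradiction
        (*-cancelˡ r-deg (≋-trans (≋-sym (eval-norm X Y))
          (≋-trans (mk≋ {eval ⟦ X ⟧ ⟦ Y ⟧} z) (≋-trans const-def (≋-sym (*-zeroʳ r))))))
        (norm≉0 X Y nonzero)
      is-lower [ d ] (X , Y , nonzero , d-deg) =
        ≤±.[ value-deg (norm-poly X Y) (Deg-cong (eval-norm X Y) (toDeg (eval ⟦ X ⟧ ⟦ Y ⟧) d-deg)) ]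

    normForm-value : IsValue normForm [ + suc k ]
    normForm-value = _ , + 1 , fromDeg disc (Deg-cong (≋-sym disc≋) (Deg-* δ-deg δ-deg)) , normForm-min , lem (+ k)
      where
      lem : ∀ k → + 2 ℤ.* (+ 1 ℤ.+ k) ≡ (+ 0 ℤ.+ (k ℤ.+ + 2)) ℤ.+ (+ 0 ℤ.+ (k ℤ.+ + 2)) ℤ.- + 2 ℤ.* + 1
      lem = solve-∀

admissible⇒markov : ∀ {v} → v ∈ Admissible → v ∈ MarkovSpectrum
admissible⇒markov {v} v∈ = let _ , r-deg , rr = sqrtΔ in go r-deg rr v v∈
  where
  go : ∀ {r} → Deg r (+ 1) → r * r ≋ Δ → ∀ v → v ∈ Admissible → v ∈ MarkovSpectrum
  go r-deg rr ⊥±          ()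
  go r-deg rr [ + zero ]  (ℤ.+≤+ ())
  go r-deg rr [ + suc k ] _ = normForm r-deg rr k , normForm-indefinite r-deg rr k , normForm-value r-deg rr k
  go r-deg rr ⊤±          _ = productForm r-deg rr , productForm-indefinite r-deg rr , productForm-value r-deg rr

theorem10 : MarkovSpectrum ≐ SequenceValues
theorem10 =
  (λ {v} v∈ → admissible⇒sequence {v} (markov⇒admissible {v} v∈)) ,
  (λ {v} v∈ → admissible⇒markov {v} (sequence⇒admissible {v} v∈))
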